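{- Let $q$ be a power of $2$, let $n$ be an odd positive integer, let $k$ be an integer satisfying $0<2k<n$ and $\gcd(k,n)=1$, and let $L_0$ be a $2$-linear polynomial over $\mathbb F_{q^n}$. Then $x^{q^k+1}+L_0(x^2)$ is a permutation polynomial of $\mathbb F_{q^n}$ if and only if $\mathrm{Tr}\big(L_0^\prime\big(u^{q^k+1}\big)u^{ -2}\big)\ne1$ for every $u\in\mathbb F_{q^n}^*$.
   Context: $\mathrm{Tr}$ is the trace map of $\mathbb F_{q^n}/\mathbb F_q$. A $2$-linear polynomial over $\mathbb F_{q^n}$ is a polynomial of the form $L(x)=\sum_ia_ix^{2^i}$ with $a_i\in\mathbb F_{q^n}$; polynomials are identified with the maps they induce on $\mathbb F_{q^n}$ (so $x^{q^n}=x$). For such $L$, define $L^\prime(x)=\sum_i(a_ix)^{2^{ -i}}$, where $x\mapsto x^{2^{ -1}}$ denotes the inverse of the automorphism $x\mapsto x^2$ of $\mathbb F_{q^n}$ (and $x\mapsto x^{2^{ -i}}$ is its $i$-th iterate). A permutation polynomial of $\mathbb F_{q^n}$ is a polynomial over $\mathbb F_{q^n}$ whose induced map on $\mathbb F_{q^n}$ is a bijection. -}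

module Defs where

open import Algebra.Bundles using (CommutativeRing)
import Algebra.Definitions as AlgebraicDefinitions
import Algebra.Properties.CommutativeMonoid.Sum as Sum
import Algebra.Properties.Ring as RingProperties
import Algebra.Properties.Semiring.Exp as Exp
import Algebra.Properties.Semiring.Mult as Mult
open import Data.Empty using (⊥-elim)
open import Data.Fin using (Fin; toℕ; punchOut)
open import Data.Fin.Permutation using (Permutation′; permutation; _⟨$⟩ʳ_)
open import Data.Fin.Properties using (any?; injective⇒≤; punchOut-injective)
  renaming (_≟_ to _≟ᶠ_)
open import Data.Nat as ℕ using (ℕ; zero; suc)
open import Data.Nat.GeneralisedArithmetic using (iterate)
open import Data.Nat.Properties using (1+n≰n; ^-*-assoc)
open import Data.Product using (∃; _,_; proj₁; proj₂)
open import Data.Vec.Functional using (Vector; replicate)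
open import Function.Bundles using (Inverse; Bijection)
open import Function.Definitions using (Injective; Surjective)
open import Function.Properties.Bijection using (Bijection⇒Inverse)
open import Level using (Level; _⊔_) renaming (suc to lsuc)
open import Relation.Binary.PropositionalEquality as ≡ using (_≡_; _≢_)
import Relation.Binary.Reasoning.Setoid as SetoidReasoning
open import Relation.Nullary using (¬_; Dec; yes; no)
open import Relation.Nullary.Decidable using (map′)

record FiniteField (c ℓ : Level) (N : ℕ) : Set (lsuc (c ⊔ ℓ)) where
  field
    commutativeRing : CommutativeRing c ℓ

  open CommutativeRing commutativeRing public
  open AlgebraicDefinitions _≈_ using (Invertible)

  field
    0≉1         : 0# ≉ 1#
    invertible  : ∀ {x} → x ≉ 0# → Invertible 1# _*_ x
    enumeration : Inverse (≡.setoid (Fin N)) setoid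

  infix 9 _⁻¹
  _⁻¹ : ∀ {x} → x ≉ 0# → Carrier
  x≉0 ⁻¹ = proj₁ (invertible x≉0)

  _≟_ : ∀ x y → Dec (x ≈ y)
  x ≟ y = map′ from-injective (Inverse.from-cong enumeration)
               (Inverse.from enumeration x ≟ᶠ Inverse.from enumeration y)
    where
    from-injective : Inverse.from enumeration x ≡ Inverse.from enumeration y → x ≈ y
    from-injective eq =
      trans (sym (Inverse.strictlyInverseˡ enumeration x)) (Inverse.inverseˡ enumeration eq)

  nonZeroDivisor : ∀ {x y} → x ≉ 0# → x * y ≈ 0# → y ≈ 0#
  nonZeroDivisor {x} {y} x≉0 xy≈0 = begin
    y                     ≈⟨ *-identityˡ y ⟨
    1# * y                ≈⟨ *-congʳ (proj₁ (proj₂ (invertible x≉0))) ⟨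
    (x≉0 ⁻¹) * x * y      ≈⟨ *-assoc _ _ _ ⟩
    (x≉0 ⁻¹) * (x * y)    ≈⟨ *-congˡ xy≈0 ⟩
    (x≉0 ⁻¹) * 0#         ≈⟨ zeroʳ _ ⟩
    0#                    ∎
    where open SetoidReasoning setoid

injective⇒surjective : ∀ {n} (f : Fin n → Fin n) → Injective _≡_ _≡_ f →
                       ∀ y → ∃ λ x → f x ≡ y
injective⇒surjective {suc n} f f-inj y with any? (λ x → f x ≟ᶠ y)
... | yes hit = hit
... | no miss = ⊥-elim (1+n≰n (injective⇒≤ {f = λ x → punchOut (y≢f x)}
                  (λ eq → f-inj (punchOut-injective (y≢f _) (y≢f _) eq))))
  where
  y≢f : ∀ x → y ≢ f x
  y≢f x eq = miss (x , ≡.sym eq)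

-- F is the field with qⁿ elements, where q = 2ᵐ.
module Extension {c ℓ : Level} (m n : ℕ) (F : FiniteField c ℓ ((2 ℕ.^ m) ℕ.^ n)) where

  open FiniteField F public
  open Exp semiring public using (_^_)
  open Sum +-commutativeMonoid public using (sum-syntax)

  q : ℕ
  q = 2 ℕ.^ m

  private
    open Sum +-commutativeMonoid
      using (sum; sum-permute; sum-cong-≋; ∑-distrib-+; sum-replicate)
    open Mult semiring using (_×_; ×-congˡ; ×1-homo-*)
    open RingProperties ring using (x+x≈x⇒x≈0; +-cancelˡ; -‿involutive)
    open SetoidReasoning setoid
    module E = Inverse enumeration

    N : ℕ
    N = q ℕ.^ n

    translate : Carrier → Fin N → Fin N
    translate a i = E.from (E.to i + a)

    translate-inverse : ∀ {a b} → a + b ≈ 0# → ∀ i → translate b (translate a i) ≡ i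
    translate-inverse {a} {b} a+b≈0 i = E.inverseʳ (begin
      E.to (translate a i) + b  ≈⟨ +-congʳ (E.strictlyInverseˡ _) ⟩
      E.to i + a + b            ≈⟨ +-assoc _ _ _ ⟩
      E.to i + (a + b)          ≈⟨ +-congˡ a+b≈0 ⟩
      E.to i + 0#               ≈⟨ +-identityʳ _ ⟩
      E.to i                    ∎)

    translation : Permutation′ N
    translation = permutation (translate 1#) (translate (- 1#))
      (translate-inverse (-‿inverseˡ 1#)) (translate-inverse (-‿inverseʳ 1#))

    N×1≈0 : N × 1# ≈ 0#
    N×1≈0 = +-cancelˡ (sum E.to) _ _ (begin
      sum E.to + N × 1#                     ≈⟨ +-congˡ (sum-replicate N) ⟨
      sum E.to + sum (replicate N 1#)       ≈⟨ ∑-distrib-+ E.to (replicate N 1#) ⟨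
      sum (λ i → E.to i + 1#)               ≈⟨ sum-cong-≋ {N} (λ i → E.strictlyInverseˡ (E.to i + 1#)) ⟨
      sum (λ i → E.to (translation ⟨$⟩ʳ i)) ≈⟨ sum-permute {N} {N} E.to translation ⟨
      sum E.to                              ≈⟨ +-identityʳ _ ⟨
      sum E.to + 0#                         ∎)

    2^e×1≉0 : 2 × 1# ≉ 0# → ∀ e → (2 ℕ.^ e) × 1# ≉ 0#
    2^e×1≉0 2≉0 zero    eq = 0≉1 (trans (sym eq) (+-identityʳ 1#))
    2^e×1≉0 2≉0 (suc e) eq = 2^e×1≉0 2≉0 e
      (nonZeroDivisor 2≉0 (trans (sym (×1-homo-* 2 (2 ℕ.^ e))) eq))

    2×1≈0 : 2 × 1# ≈ 0#
    2×1≈0 with (2 × 1#) ≟ 0#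
    ... | yes 2≈0 = 2≈0
    ... | no  2≉0 = ⊥-elim (2^e×1≉0 2≉0 (m ℕ.* n)
                      (trans (×-congˡ (≡.sym (^-*-assoc 2 m n))) N×1≈0))

  x+x≈0 : ∀ x → x + x ≈ 0#
  x+x≈0 x = begin
    x + x              ≈⟨ +-cong (*-identityˡ x) (*-identityˡ x) ⟨
    1# * x + 1# * x    ≈⟨ distribʳ x 1# 1# ⟨
    (1# + 1#) * x      ≈⟨ *-congʳ (+-congˡ (+-identityʳ 1#)) ⟨
    (2 × 1#) * x       ≈⟨ *-congʳ 2×1≈0 ⟩
    0# * x             ≈⟨ zeroˡ x ⟩
    0#                 ∎

  private
    ^2≈* : ∀ x → x ^ 2 ≈ x * x
    ^2≈* x = *-congˡ (*-identityʳ x)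

    ^2-cong : ∀ {x y} → x ≈ y → x ^ 2 ≈ y ^ 2
    ^2-cong x≈y = *-cong x≈y (*-congʳ x≈y)

    ^2-injective : Injective _≈_ _≈_ (_^ 2)
    ^2-injective {x} {y} x²≈y² with (x + y) ≟ 0#
    ... | yes x+y≈0 = +-cancelˡ y _ _ (trans (+-comm y x) (trans x+y≈0 (sym (x+x≈0 y))))
    ... | no  x+y≉0 = ⊥-elim (x+y≉0 (nonZeroDivisor x+y≉0 (begin
      (x + y) * (x + y)                  ≈⟨ distribʳ _ _ _ ⟩
      x * (x + y) + y * (x + y)          ≈⟨ +-cong (distribˡ _ _ _) (distribˡ _ _ _) ⟩
      x * x + x * y + (y * x + y * y)    ≈⟨ +-cong (+-comm _ _) (+-cong (*-comm y x) (sym x*x≈y*y)) ⟩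
      x * y + x * x + (x * y + x * x)    ≈⟨ x+x≈0 _ ⟩
      0#                                 ∎)))
      where
      x*x≈y*y : x * x ≈ y * y
      x*x≈y*y = trans (sym (^2≈* x)) (trans x²≈y² (^2≈* y))

    square : Fin N → Fin N
    square i = E.from (E.to i ^ 2)

    square-injective : Injective _≡_ _≡_ square
    square-injective {i} {j} eq = ≡.trans (≡.sym (E.strictlyInverseʳ i)) (E.inverseʳ (^2-injective (begin
      E.to i ^ 2         ≈⟨ E.strictlyInverseˡ _ ⟨
      E.to (square i)    ≈⟨ E.to-cong eq ⟩
      E.to (square j)    ≈⟨ E.strictlyInverseˡ _ ⟩
      E.to j ^ 2         ∎)))

    ^2-surjective : Surjective _≈_ _≈_ (_^ 2)
    ^2-surjective y with i , eq ← injective⇒surjective square square-injective (E.from y) =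
      E.to i , λ {z} z≈i → begin
        z ^ 2              ≈⟨ ^2-cong z≈i ⟩
        E.to i ^ 2         ≈⟨ E.strictlyInverseˡ _ ⟨
        E.to (square i)    ≈⟨ E.to-cong eq ⟩
        E.to (E.from y)    ≈⟨ E.strictlyInverseˡ y ⟩
        y                  ∎

  frobenius : Bijection setoid setoid
  frobenius = record
    { to        = _^ 2
    ; cong      = ^2-cong
    ; bijective = ^2-injective , ^2-surjective
    }

  √ : Carrier → Carrier
  √ = Inverse.from (Bijection⇒Inverse frobenius)

  -- The trace of F over its subfield with q elements, as an element of F.
  Tr : Carrier → Carrier
  Tr x = ∑[ i < n ] (x ^ (q ℕ.^ toℕ i))

  -- The map induced by the 2-linear polynomial with coefficients a₀, …, a_{d-1}.
  linear : ∀ {d} → Vector Carrier d → Carrier → Carrier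
  linear {d} a x = ∑[ i < d ] (a i * x ^ (2 ℕ.^ toℕ i))

  -- L′, for L = linear a.
  linear′ : ∀ {d} → Vector Carrier d → Carrier → Carrier
  linear′ {d} a x = ∑[ i < d ] iterate √ (a i * x) (toℕ i)

{-# OPTIONS --safe #-}

-- For u ≠ 0 let b = L₀′(u^(q^k+1)) u⁻². Since L₀′ is the adjoint of L₀ for the absolute
-- trace, substituting x = u⁻¹ y turns the character sum ∑ₓ χ(u^(q^k+1) f(x)) of
-- f(x) = x^(q^k+1) + L₀(x²) into ∑ᵧ χ(y^(q^k+1) + b y²). The quadratic form
-- tr(y^(q^k+1) + b y²) has radical 𝔽_q, on which it equals tr((1 + b) y²), so the sum
-- vanishes exactly when Tr(1 + b) ≠ 0, that is, when Tr(b) ≠ 1. Finally x ↦ x^(q^k+1)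
-- permutes the field, and f does so exactly when all its nontrivial character sums vanish.
module Submission where

open import Defs
open import Data.Nat as ℕ using (ℕ; _<_; _%_)
open import Data.Nat.GCD using (gcd)
open import Data.Vec.Functional using (Vector)
open import Function.Bundles using (_⇔_)
open import Function.Definitions using (Bijective)
open import Relation.Binary.PropositionalEquality using (_≡_)

open import Algebra.Bundles using (CommutativeMonoid; CommutativeRing; RawRing)
import Algebra.Properties.CommutativeMonoid.Sum as MonoidSum
import Algebra.Properties.CommutativeSemiring.Exp as CommutativeExp
import Algebra.Properties.Ring as RingProperties
import Algebra.Properties.Semiring.Exp as Exp
import Algebra.Properties.Semiring.Sum as SemiringSum
import Algebra.Solver.Ring as RingSolver
open import Algebra.Solver.Ring.AlmostCommutativeRing using (fromCommutativeRing; _-Raw-AlmostCommutative⟶_)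
import Algebra.Solver.Ring.NaturalCoefficients.Default as SemiringSolver
open import Data.Bool using (Bool; true; false; _xor_; _∧_; if_then_else_)
open import Data.Empty using (⊥; ⊥-elim)
open import Data.Fin as Fin using (Fin; toℕ)
open import Data.Fin.Permutation using (Permutation′; permutation)
import Data.Fin.Properties as Fin
open import Data.Integer as ℤ using (ℤ; +_; -[1+_])
import Data.Integer.Properties as ℤ
open import Data.Maybe using (Maybe; just; nothing)
open import Data.Nat using (zero; suc)
open import Data.Nat.Coprimality using (Coprime; coprime-Bézout; coprime-divisor; gcd≡1⇒coprime)
open import Data.Nat.Divisibility using (∣-trans; n∣m⇒m%n≡0)
import Data.Nat.DivMod as ℕ
open import Data.Nat.GCD using (module Bézout)
open import Data.Nat.GeneralisedArithmetic using (iterate)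
open import Data.Nat.Primality using (prime⇒irreducible; prime[2])
import Data.Nat.Properties as ℕ
open import Data.Product using (∃; _,_; proj₁; proj₂; _×_)
open import Data.Sum using (inj₁; inj₂)
open import Function.Bundles using (Bijection; Inverse; mk⇔)
open import Function.Definitions using (Congruent; Injective)
open import Function.Properties.Bijection using (Bijection⇒Inverse)
open import Relation.Binary.PropositionalEquality as ≡ using (_≢_)
import Relation.Binary.Reasoning.Setoid as SetoidReasoning
open import Relation.Nullary using (¬_; Dec; yes; no)

-- Write Q = q^k. Polarisation gives tr(x^Q y + x y^Q), and invariance of the trace under Q-th
-- powers turns this into tr(x^Q (y + y^(Q²))). The radical is therefore the fixed set of y ↦
-- y^(Q²). Oddness of n gives gcd(2k, n) = 1, which makes this set the field with q elements; the
-- same fact makes x^(q^k+1) injective. Oddness also gives Tr(1) = 1, which turns Tr(1 + b) ≠ 0 into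
-- Tr(b) ≠ 1. No character sum is evaluated. In characteristic 2 the characters take the values 1
-- and -1, so all sums live in ℤ. A sum vanishes because some translation reverses the sign of every
-- term; it is nonzero because it, or its square, is a sum of nonnegative terms of which one is
-- positive. Neither the size of the radical nor an absolute value is computed.

surjective⇒injective : ∀ {s} (f : Fin s → Fin s) → (∀ y → ∃ λ x → f x ≡ y) → Injective _≡_ _≡_ f
surjective⇒injective {s} f f-surj {x} {y} fx≡fy =
  ≡.trans (≡.sym (section-retraction x)) (≡.trans (≡.cong section fx≡fy) (section-retraction y))
  where
  section : Fin s → Fin s
  section y = proj₁ (f-surj y)
  section-injective : Injective _≡_ _≡_ section
  section-injective {y} {z} eq =
    ≡.trans (≡.sym (proj₂ (f-surj y))) (≡.trans (≡.cong f eq) (proj₂ (f-surj z)))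
  section-retraction : ∀ x → section (f x) ≡ x
  -- The section is injective, hence onto, so `x` may be taken of the form `section y`, where the
  -- claim is immediate.
  section-retraction x with y , ≡.refl ← injective⇒surjective section section-injective x =
    ≡.cong section (proj₂ (f-surj y))

-- Self-maps of a finite field as self-maps of its index set

module FieldMaps {c ℓ N} (F : FiniteField c ℓ N) where

  open FiniteField F
  private module E = Inverse enumeration

  module _ (f : Carrier → Carrier) (f-cong : Congruent _≈_ _≈_ f) where

    index : Fin N → Fin N
    index i = E.from (f (E.to i))

    to-index : ∀ i → E.to (index i) ≈ f (E.to i)
    to-index i = E.strictlyInverseˡ _

    module _ (f-inj : Injective _≈_ _≈_ f) where

      index-injective : Injective _≡_ _≡_ index
      index-injective {i} {j} eq = ≡.trans (≡.sym (E.strictlyInverseʳ i)) (E.inverseʳ (f-inj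
        (trans (sym (to-index i)) (trans (E.to-cong eq) (to-index j)))))

      index-surjective : ∀ j → ∃ λ i → index i ≡ j
      index-surjective = injective⇒surjective index index-injective

      index-permutation : Permutation′ N
      index-permutation = permutation index (λ j → proj₁ (index-surjective j))
        (λ j → proj₂ (index-surjective j))
        (λ i → index-injective (proj₂ (index-surjective (index i))))

      injective⇒strictlySurjective : ∀ y → ∃ λ x → f x ≈ y
      injective⇒strictlySurjective y with i , eq ← index-surjective (E.from y) =
        E.to i , trans (sym (to-index i)) (trans (E.to-cong eq) (E.strictlyInverseˡ y))

    strictlySurjective⇒injective : (∀ y → ∃ λ x → f x ≈ y) → Injective _≈_ _≈_ f
    strictlySurjective⇒injective f-surj {x} {y} fx≈fy = begin
      x                ≈⟨ E.strictlyInverseˡ x ⟨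
      E.to (E.from x)  ≡⟨ ≡.cong E.to (surjective⇒injective index index-surj (E.from-cong f-from)) ⟩
      E.to (E.from y)  ≈⟨ E.strictlyInverseˡ y ⟩
      y                ∎
      where
      open SetoidReasoning setoid
      f-from : f (E.to (E.from x)) ≈ f (E.to (E.from y))
      f-from = trans (f-cong (E.strictlyInverseˡ x)) (trans fx≈fy (sym (f-cong (E.strictlyInverseˡ y))))
      index-surj : ∀ j → ∃ λ i → index i ≡ j
      index-surj j with x , eq ← f-surj (E.to j) =
        E.from x , E.inverseʳ (trans (f-cong (E.strictlyInverseˡ x)) eq)

  hit? : ∀ f → Congruent _≈_ _≈_ f → ∀ y → Dec (∃ λ x → f x ≈ y)
  hit? f f-cong y with Fin.any? (λ i → f (E.to i) ≟ y)
  ... | yes (i , eq) = yes (E.to i , eq)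
  ... | no  miss     = no λ (x , eq) → miss (E.from x , trans (f-cong (E.strictlyInverseˡ x)) eq)

-- Sums over the field with values in a commutative monoid

module FieldSum {c ℓ N} (F : FiniteField c ℓ N) {a ℓ′} (M : CommutativeMonoid a ℓ′) where

  open FiniteField F
  open FieldMaps F
  open MonoidSum M
  private
    module E = Inverse enumeration
    module M = CommutativeMonoid M

  ∑F : (Carrier → M.Carrier) → M.Carrier
  ∑F h = sum (λ i → h (E.to i))

  ∑F-cong : ∀ {g h} → (∀ x → g x M.≈ h x) → ∑F g M.≈ ∑F h
  ∑F-cong g≈h = sum-cong-≋ (λ i → g≈h (E.to i))

  ∑F-comm : ∀ (g : Carrier → Carrier → M.Carrier) → ∑F (λ x → ∑F (g x)) M.≈ ∑F (λ y → ∑F (λ x → g x y))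
  ∑F-comm g = ∑-comm (λ i j → g (E.to i) (E.to j))

  ∑F-∙ : ∀ g h → ∑F (λ x → g x M.∙ h x) M.≈ ∑F g M.∙ ∑F h
  ∑F-∙ g h = ∑-distrib-+ (λ i → g (E.to i)) (λ i → h (E.to i))

  ∑F-reindex : ∀ {h} → Congruent _≈_ M._≈_ h → ∀ f → Congruent _≈_ _≈_ f → Injective _≈_ _≈_ f →
               ∑F (λ x → h (f x)) M.≈ ∑F h
  ∑F-reindex {h} h-cong f f-cong f-inj = M.trans
    (sum-cong-≋ (λ i → h-cong (sym (to-index f f-cong i))))
    (M.sym (sum-permute (λ i → h (E.to i)) (index-permutation f f-cong f-inj)))

  ∑F-ε : ∀ {h} → (∀ x → h x M.≈ M.ε) → ∑F h M.≈ M.ε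
  ∑F-ε h≈ε = M.trans (∑F-cong h≈ε) (sum-replicate-zero N)

  sum-single : ∀ {s} (t : Fin s → M.Carrier) i → (∀ j → j ≢ i → t j M.≈ M.ε) → sum t M.≈ t i
  sum-single {suc s} t i rest = M.trans (sum-remove {i = i} t) (M.trans
    (M.∙-congˡ (M.trans (sum-cong-≋ (λ j → rest _ (Fin.punchInᵢ≢i i j))) (sum-replicate-zero s)))
    (M.identityʳ _))

  ∑F-single : ∀ {h} → Congruent _≈_ M._≈_ h → ∀ a → (∀ x → x ≉ a → h x M.≈ M.ε) → ∑F h M.≈ h a
  ∑F-single {h} h-cong a rest = M.trans
    (sum-single (λ i → h (E.to i)) (E.from a)
      (λ j j≢ → rest _ (λ eq → j≢ (≡.sym (E.inverseʳ (sym eq))))))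
    (h-cong (E.strictlyInverseˡ a))

-- The identity x^N = x and the roots of polynomial functions

module FieldPowers {c ℓ N} (F : FiniteField c ℓ N) where

  open FiniteField F
  open Exp semiring
  open RingProperties ring using (x∙y⁻¹≈ε⇒x≈y; -‿distribˡ-*)
  open SetoidReasoning setoid
  private module E = Inverse enumeration

  ⁻¹-inverseˡ : ∀ {x} (x≉0 : x ≉ 0#) → (x≉0 ⁻¹) * x ≈ 1#
  ⁻¹-inverseˡ x≉0 = proj₁ (proj₂ (invertible x≉0))

  ⁻¹-inverseʳ : ∀ {x} (x≉0 : x ≉ 0#) → x * (x≉0 ⁻¹) ≈ 1#
  ⁻¹-inverseʳ x≉0 = proj₂ (proj₂ (invertible x≉0))

  *-cancelˡ : ∀ {a x y} → a ≉ 0# → a * x ≈ a * y → x ≈ y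
  *-cancelˡ {a} {x} {y} a≉0 eq = begin
    x                     ≈⟨ step x ⟨
    (a≉0 ⁻¹) * (a * x)    ≈⟨ *-congˡ eq ⟩
    (a≉0 ⁻¹) * (a * y)    ≈⟨ step y ⟩
    y                     ∎
    where
    step : ∀ z → (a≉0 ⁻¹) * (a * z) ≈ z
    step z = trans (sym (*-assoc _ _ _)) (trans (*-congʳ (⁻¹-inverseˡ a≉0)) (*-identityˡ z))

  *-≉0 : ∀ {x y} → x ≉ 0# → y ≉ 0# → x * y ≉ 0#
  *-≉0 x≉0 y≉0 xy≈0 = y≉0 (nonZeroDivisor x≉0 xy≈0)

  ^-≉0 : ∀ {x} → x ≉ 0# → ∀ e → x ^ e ≉ 0#
  ^-≉0 x≉0 zero    eq = 0≉1 (sym eq)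
  ^-≉0 x≉0 (suc e) = *-≉0 x≉0 (^-≉0 x≉0 e)

  open FieldSum F *-commutativeMonoid
    renaming (∑F to ∏F; ∑F-cong to ∏F-cong; ∑F-∙ to ∏F-*; ∑F-reindex to ∏F-reindex; ∑F-single to ∏F-single)
  open MonoidSum *-commutativeMonoid using () renaming (sum to product; sum-replicate to product-replicate)

  product-≉0 : ∀ {s} (t : Fin s → Carrier) → (∀ i → t i ≉ 0#) → product t ≉ 0#
  product-≉0 {zero}  t t≉0 eq = 0≉1 (sym eq)
  product-≉0 {suc s} t t≉0 = *-≉0 (t≉0 Fin.zero) (product-≉0 (λ i → t (Fin.suc i)) (λ i → t≉0 (Fin.suc i)))

  -- The inhabitant of `Fin s` only certifies that `s` is positive; for `s = N` the index of 0
  -- serves.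
  0^s≈0 : ∀ {s} → Fin s → 0# ^ s ≈ 0#
  0^s≈0 {suc s} _ = zeroˡ _

  private
    at0 : Carrier → Carrier → Carrier → Carrier
    at0 u v x with x ≟ 0#
    ... | yes _ = u
    ... | no  _ = v

    at0-0 : ∀ u v {x} → x ≈ 0# → at0 u v x ≈ u
    at0-0 u v {x} x≈0 with x ≟ 0#
    ... | yes _   = refl
    ... | no  x≉0 = ⊥-elim (x≉0 x≈0)

    at0-≉0 : ∀ u v {x} → x ≉ 0# → at0 u v x ≈ v
    at0-≉0 u v {x} x≉0 with x ≟ 0#
    ... | yes x≈0 = ⊥-elim (x≉0 x≈0)
    ... | no  _   = refl

    at0-cong : ∀ {u v u′ v′ x y} → u ≈ u′ → v ≈ v′ → x ≈ y → at0 u v x ≈ at0 u′ v′ y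
    at0-cong {u} {v} {u′} {v′} {x} {y} u≈ v≈ x≈y with x ≟ 0#
    ... | yes x≈0 = trans u≈ (sym (at0-0 _ _ (trans (sym x≈y) x≈0)))
    ... | no  x≉0 = trans v≈ (sym (at0-≉0 _ _ (λ y≈0 → x≉0 (trans x≈y y≈0))))

  -- Multiplication by x permutes the field, so ∏ y over y ≉ 0 does not change when
  -- each factor y is replaced by x * y; the factor at y ≈ 0 is set to 1 in both products.
  x^N≈x : ∀ x → x ^ N ≈ x
  x^N≈x x with x ≟ 0#
  ... | yes x≈0 = trans (^-congˡ N x≈0) (trans (0^s≈0 (E.from 0#)) (sym x≈0))
  ... | no  x≉0 = *-cancelˡ P≉0 (begin
    P * x ^ N                                   ≈⟨ *-comm _ _ ⟩
    x ^ N * P                                   ≈⟨ *-congʳ (product-replicate N) ⟨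
    ∏F (λ _ → x) * P                            ≈⟨ ∏F-* (λ _ → x) p ⟨
    ∏F (λ y → x * p y)                          ≈⟨ ∏F-cong pointwise ⟨
    -- The product on the left has a factor `x` at y ≈ 0 as well. `at0 x 1#` carries this surplus
    -- factor, so the result is x^N ≈ x and not x^(N-1) ≈ 1.
    ∏F (λ y → p (x * y) * at0 x 1# y)           ≈⟨ ∏F-* (λ y → p (x * y)) (at0 x 1#) ⟩
    ∏F (λ y → p (x * y)) * ∏F (at0 x 1#)        ≈⟨ *-cong
      (∏F-reindex (λ y≈z → at0-cong refl y≈z y≈z) (x *_) *-congˡ (*-cancelˡ x≉0))
      (trans (∏F-single (at0-cong refl refl) 0# (λ _ → at0-≉0 x 1#)) (at0-0 x 1# refl)) ⟩
    P * x                                       ∎)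
    where
    p : Carrier → Carrier
    p y = at0 1# y y
    P : Carrier
    P = ∏F p
    p-≉0 : ∀ y → p y ≉ 0#
    p-≉0 y with y ≟ 0#
    ... | yes _   = λ eq → 0≉1 (sym eq)
    ... | no  y≉0 = y≉0
    P≉0 : P ≉ 0#
    P≉0 = product-≉0 (λ i → p (E.to i)) (λ i → p-≉0 (E.to i))
    pointwise : ∀ y → p (x * y) * at0 x 1# y ≈ x * p y
    pointwise y with y ≟ 0#
    ... | yes y≈0 = trans (*-congʳ (at0-0 1# _ (trans (*-congˡ y≈0) (zeroʳ x)))) (*-comm 1# x)
    ... | no  y≉0 = trans (*-identityʳ _) (at0-≉0 1# _ (*-≉0 x≉0 y≉0))

  -- Horner form imposed on functions: polynomials of degree below `d` here, and monic ones of
  -- degree exactly `d` in `Monic`. Only values matter for counting roots, so no type of formal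
  -- polynomials is involved.
  Polynomial< : ℕ → (Carrier → Carrier) → Set _
  Polynomial< zero    f = ∀ x → f x ≈ 0#
  Polynomial< (suc d) f = ∃ λ a → ∃ λ g → Polynomial< d g × (∀ x → f x ≈ a + x * g x)

  Monic : ℕ → (Carrier → Carrier) → Set _
  Monic zero    f = ∀ x → f x ≈ 1#
  Monic (suc d) f = ∃ λ a → ∃ λ g → Monic d g × (∀ x → f x ≈ a + x * g x)

  open SemiringSolver commutativeSemiring using (solve; _:=_; _:+_; _:*_)

  monic+< : ∀ d {f g} → Monic d f → Polynomial< d g → Monic d (λ x → f x + g x)
  monic+< zero    f≈1 g≈0 x = trans (+-cong (f≈1 x) (g≈0 x)) (+-identityʳ 1#)
  monic+< (suc d) (a , f , f-monic , f≈) (b , g , g< , g≈) =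
    a + b , (λ x → f x + g x) , monic+< d f-monic g< , λ x → trans (+-cong (f≈ x) (g≈ x))
      (solve 5 (λ a b x u v → (a :+ x :* u) :+ (b :+ x :* v) := (a :+ b) :+ x :* (u :+ v)) refl a b x (f x) (g x))

  ^-monic : ∀ d → Monic d (_^ d)
  ^-monic zero    x = refl
  ^-monic (suc d) = 0# , (_^ d) , ^-monic d , λ x → sym (+-identityˡ _)

  monic⇒< : ∀ d {f} → Monic d f → Polynomial< (suc d) f
  monic⇒< zero    f≈1 = 1# , (λ _ → 0#) , (λ _ → refl) ,
    λ x → trans (f≈1 x) (sym (trans (+-congˡ (zeroʳ x)) (+-identityʳ 1#)))
  monic⇒< (suc d) (a , g , g-monic , f≈) = a , g , monic⇒< d g-monic , f≈

  0-< : ∀ d → Polynomial< d (λ _ → 0#)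
  0-< zero    x = refl
  0-< (suc d) = 0# , (λ _ → 0#) , 0-< d , λ x → sym (trans (+-identityˡ _) (zeroʳ x))

  <-weaken : ∀ {d e f} → d ℕ.≤ e → Polynomial< d f → Polynomial< e f
  <-weaken {e = zero}  ℕ.z≤n f≈0 = f≈0
  <-weaken {e = suc e} ℕ.z≤n f≈0 = 0# , (λ _ → 0#) , 0-< e ,
    λ x → trans (f≈0 x) (sym (trans (+-identityˡ _) (zeroʳ x)))
  <-weaken (ℕ.s≤s d≤e) (a , g , g< , f≈) = a , g , <-weaken d≤e g< , f≈

  Monic-cong : ∀ d {f g} → (∀ x → f x ≈ g x) → Monic d f → Monic d g
  Monic-cong zero    f≈g f≈1 x = trans (sym (f≈g x)) (f≈1 x)
  Monic-cong (suc d) f≈g (a , h , h-monic , f≈) = a , h , h-monic , λ x → trans (sym (f≈g x)) (f≈ x)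

  -- f x - f a = (x - a) h x, with the subtractions moved to the other side.
  factor : ∀ d {f} → Monic (suc d) f → ∀ a →
           ∃ λ h → Monic d h × (∀ x → f x + a * h x ≈ f a + x * h x)
  factor zero {f} (c , g , g≈1 , f≈) a = g , g≈1 , λ x → begin
    f x + a * g x            ≈⟨ +-cong (f≈ x) (*-congˡ (trans (g≈1 x) (sym (g≈1 a)))) ⟩
    c + x * g x + a * g a    ≈⟨ solve 3 (λ c u v → c :+ u :+ v := c :+ v :+ u) refl c (x * g x) (a * g a) ⟩
    c + a * g a + x * g x    ≈⟨ +-congʳ (f≈ a) ⟨
    f a + x * g x            ∎
  factor (suc d) {f} (c , g , g-monic , f≈) a with factor d g-monic a
  ... | h , h-monic , eq = (λ x → g a + x * h x) , (g a , h , h-monic , λ _ → refl) , λ x → begin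
    f x + a * (g a + x * h x)                      ≈⟨ +-congʳ (f≈ x) ⟩
    c + x * g x + a * (g a + x * h x)              ≈⟨ solve 6 (λ c x a u v w →
      c :+ x :* u :+ a :* (v :+ x :* w) := c :+ a :* v :+ x :* (u :+ a :* w)) refl c x a (g x) (g a) (h x) ⟩
    c + a * g a + x * (g x + a * h x)              ≈⟨ +-cong (sym (f≈ a)) (*-congˡ (eq x)) ⟩
    f a + x * (g a + x * h x)                      ∎

  -- Splitting off the linear factor of the first root leaves a monic cofactor of degree one less.
  -- It vanishes at the other roots, because they differ from the first and there are no zero
  -- divisors.
  monic-roots : ∀ d {f s} → Monic d f → (r : Fin s → Carrier) → Injective _≡_ _≈_ r → d < s →
                (∀ i → f (r i) ≈ 0#) → ⊥
  monic-roots zero    {s = suc s} f≈1 r r-inj d<s root =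
    0≉1 (trans (sym (root Fin.zero)) (f≈1 _))
  monic-roots (suc d) {f} {suc s} f-monic r r-inj (ℕ.s≤s d<s) root with factor d f-monic (r Fin.zero)
  ... | h , h-monic , eq = monic-roots d h-monic (λ i → r (Fin.suc i))
    (λ e → Fin.suc-injective (r-inj e)) d<s root′
    where
    a = r Fin.zero
    root′ : ∀ i → h (r (Fin.suc i)) ≈ 0#
    root′ i = nonZeroDivisor {x = x - a}
      (λ x-a≈0 → Fin.0≢1+n (r-inj (sym (x∙y⁻¹≈ε⇒x≈y x a x-a≈0)))) (begin
      (x - a) * h x             ≈⟨ distribʳ _ _ _ ⟩
      x * h x + - a * h x       ≈⟨ +-congˡ (-‿distribˡ-* a (h x)) ⟨
      x * h x + - (a * h x)     ≈⟨ +-congˡ (-‿cong ah≈xh) ⟩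
      x * h x + - (x * h x)     ≈⟨ -‿inverseʳ _ ⟩
      0#                        ∎)
      where
      x = r (Fin.suc i)
      ah≈xh : a * h x ≈ x * h x
      ah≈xh = begin
        a * h x            ≈⟨ +-identityˡ _ ⟨
        0# + a * h x       ≈⟨ +-congʳ (root (Fin.suc i)) ⟨
        f x + a * h x      ≈⟨ eq x ⟩
        f a + x * h x      ≈⟨ +-congʳ (root Fin.zero) ⟩
        0# + x * h x       ≈⟨ +-identityˡ _ ⟩
        x * h x            ∎

  monic-nonvanishing : ∀ d {f} → Monic d f → Congruent _≈_ _≈_ f → d < N → ∃ λ x → f x ≉ 0#
  monic-nonvanishing d {f} f-monic f-cong d<N with Fin.all? (λ i → f (E.to i) ≟ 0#)
  ... | yes f≈0 = ⊥-elim (monic-roots d f-monic E.to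
                    (λ {i} {j} eq → ≡.trans (≡.sym (E.strictlyInverseʳ i)) (E.inverseʳ eq)) d<N f≈0)
  ... | no  ¬f≈0 with Fin.¬∀⟶∃¬ N _ (λ i → f (E.to i) ≟ 0#) ¬f≈0
  ...   | i , fi≉0 = E.to i , fi≉0

-- Traces as sums of Frobenius powers in characteristic 2

module Traces {c ℓ} (m n : ℕ) (F : FiniteField c ℓ ((2 ℕ.^ m) ℕ.^ n)) where

  open Extension m n F
  open Exp semiring using (^-congˡ; ^-congʳ; ^-assocʳ)
  open FieldPowers F
  open SemiringSum semiring using (sum; sum-cong-≋; ∑-distrib-+; sum-init-last)
  open RingProperties ring using (+-cancelˡ; +-cancelʳ)
  open SetoidReasoning setoid

  -- With coefficients in 𝔽₂ the ring solver cancels x + x.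
  𝔽₂ : RawRing _ _
  𝔽₂ = record { Carrier = Bool ; _≈_ = _≡_ ; _+_ = _xor_ ; _*_ = _∧_ ; -_ = λ b → b ; 0# = false ; 1# = true }

  x+y≈0⇒x≈y : ∀ {x y} → x + y ≈ 0# → x ≈ y
  x+y≈0⇒x≈y {x} {y} eq = +-cancelʳ y x y (trans eq (sym (x+x≈0 y)))

  𝔽₂⟶F : 𝔽₂ -Raw-AlmostCommutative⟶ fromCommutativeRing commutativeRing
  𝔽₂⟶F = record
    { ⟦_⟧    = λ b → if b then 1# else 0#
    ; +-homo = λ { true  true  → sym (x+x≈0 1#)
                 ; true  false → sym (+-identityʳ 1#)
                 ; false b     → sym (+-identityˡ _) }
    ; *-homo = λ { true  b → sym (*-identityˡ _)
                 ; false b → sym (zeroˡ _) }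
    ; -‿homo = λ _ → x+y≈0⇒x≈y (-‿inverseʳ _)
    ; 0-homo = refl
    ; 1-homo = refl
    }

  _≟𝔽₂_ : ∀ a b → Maybe ((if a then 1# else 0#) ≈ (if b then 1# else 0#))
  true  ≟𝔽₂ true  = just refl
  false ≟𝔽₂ false = just refl
  _     ≟𝔽₂ _     = nothing

  open RingSolver 𝔽₂ (fromCommutativeRing commutativeRing) 𝔽₂⟶F _≟𝔽₂_
    public using (solve; _:=_; _:+_; _:*_; con)

  ^2^-distrib-+ : ∀ e x y → (x + y) ^ (2 ℕ.^ e) ≈ x ^ (2 ℕ.^ e) + y ^ (2 ℕ.^ e)
  ^2^-distrib-+ zero    x y = distribʳ 1# x y
  ^2^-distrib-+ (suc e) x y = begin
    (x + y) ^ (2 ℕ.* 2 ℕ.^ e)                        ≈⟨ ^-assocʳ (x + y) 2 (2 ℕ.^ e) ⟨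
    ((x + y) ^ 2) ^ (2 ℕ.^ e)                        ≈⟨ ^-congˡ (2 ℕ.^ e) (solve 2 (λ x y →
      (x :+ y) :* ((x :+ y) :* con true) := x :* (x :* con true) :+ y :* (y :* con true)) refl x y) ⟩
    (x ^ 2 + y ^ 2) ^ (2 ℕ.^ e)                      ≈⟨ ^2^-distrib-+ e (x ^ 2) (y ^ 2) ⟩
    (x ^ 2) ^ (2 ℕ.^ e) + (y ^ 2) ^ (2 ℕ.^ e)        ≈⟨ +-cong (^-assocʳ x 2 (2 ℕ.^ e)) (^-assocʳ y 2 (2 ℕ.^ e)) ⟩
    x ^ (2 ℕ.* 2 ℕ.^ e) + y ^ (2 ℕ.* 2 ℕ.^ e)        ∎

  module Additive (φ : Carrier → Carrier) (φ-cong : Congruent _≈_ _≈_ φ)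
                  (φ-+ : ∀ x y → φ (x + y) ≈ φ x + φ y) where

    φ-0 : φ 0# ≈ 0#
    φ-0 = begin
      φ 0#                 ≈⟨ φ-cong (+-identityˡ 0#) ⟨
      φ (0# + 0#)          ≈⟨ φ-+ 0# 0# ⟩
      φ 0# + φ 0#          ≈⟨ x+x≈0 _ ⟩
      0#                   ∎

    φ-sum : ∀ {s} (t : Vector Carrier s) → φ (sum t) ≈ sum (λ i → φ (t i))
    φ-sum {zero}  t = φ-0
    φ-sum {suc s} t = trans (φ-+ _ _) (+-congˡ (φ-sum (λ i → t (Fin.suc i))))

  module ^2^ (e : ℕ) = Additive (_^ (2 ℕ.^ e)) (^-congˡ (2 ℕ.^ e)) (^2^-distrib-+ e)

  1^ : ∀ a → 1# ^ a ≈ 1#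
  1^ zero    = refl
  1^ (suc a) = trans (*-identityˡ _) (1^ a)

  ^-comm : ∀ x a b → (x ^ a) ^ b ≈ (x ^ b) ^ a
  ^-comm x a b = begin
    (x ^ a) ^ b      ≈⟨ ^-assocʳ x a b ⟩
    x ^ (a ℕ.* b)    ≈⟨ ^-congʳ x (ℕ.*-comm a b) ⟩
    x ^ (b ℕ.* a)    ≈⟨ ^-assocʳ x b a ⟨
    (x ^ b) ^ a      ∎

  -- trace m n is Tr, and trace 1 (n * m) is the trace to the prime field.
  trace : ℕ → ℕ → Carrier → Carrier
  trace e s x = ∑[ i < s ] (x ^ ((2 ℕ.^ e) ℕ.^ toℕ i))

  trace-cong : ∀ e s → Congruent _≈_ _≈_ (trace e s)
  trace-cong e s x≈y = sum-cong-≋ {s} (λ i → ^-congˡ ((2 ℕ.^ e) ℕ.^ toℕ i) x≈y)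

  trace-distrib-+ : ∀ e s x y → trace e s (x + y) ≈ trace e s x + trace e s y
  trace-distrib-+ e s x y = trans
    (sum-cong-≋ {s} (λ i → frob (toℕ i)))
    (∑-distrib-+ {s} (λ i → x ^ ((2 ℕ.^ e) ℕ.^ toℕ i)) (λ i → y ^ ((2 ℕ.^ e) ℕ.^ toℕ i)))
    where
    frob : ∀ i → (x + y) ^ ((2 ℕ.^ e) ℕ.^ i) ≈ x ^ ((2 ℕ.^ e) ℕ.^ i) + y ^ ((2 ℕ.^ e) ℕ.^ i)
    frob i rewrite ℕ.^-*-assoc 2 e i = ^2^-distrib-+ (e ℕ.* i) x y

  module Trace (e s : ℕ) = Additive (trace e s) (trace-cong e s) (trace-distrib-+ e s)

  trace-suc : ∀ e s x → trace e (suc s) x ≈ x + trace e s (x ^ (2 ℕ.^ e))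
  trace-suc e s x = +-cong (*-identityʳ x)
    (sum-cong-≋ {s} (λ i → sym (^-assocʳ x (2 ℕ.^ e) ((2 ℕ.^ e) ℕ.^ toℕ i))))

  trace-last : ∀ e s x → trace e (suc s) x ≈ trace e s x + x ^ ((2 ℕ.^ e) ℕ.^ s)
  trace-last e s x = trans (sum-init-last {s} (λ i → x ^ ((2 ℕ.^ e) ℕ.^ toℕ i))) (+-cong
    (sum-cong-≋ {s} (λ i → ^-congʳ x (≡.cong ((2 ℕ.^ e) ℕ.^_) (Fin.toℕ-inject₁ i))))
    (^-congʳ x (≡.cong ((2 ℕ.^ e) ℕ.^_) (Fin.toℕ-fromℕ s))))

  trace-^ : ∀ e s j x → trace e s x ^ (2 ℕ.^ j) ≈ trace e s (x ^ (2 ℕ.^ j))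
  trace-^ e s j x = trans (^2^.φ-sum j (λ (i : Fin s) → x ^ ((2 ℕ.^ e) ℕ.^ toℕ i)))
    (sum-cong-≋ {s} (λ i → ^-comm x ((2 ℕ.^ e) ℕ.^ toℕ i) (2 ℕ.^ j)))

  -- The sum with one more term can be split at its first term or at its last; when `x` is fixed
  -- both split terms equal `x` and cancel.
  trace-fixed : ∀ e s {x} → x ^ ((2 ℕ.^ e) ℕ.^ s) ≈ x → trace e s (x ^ (2 ℕ.^ e)) ≈ trace e s x
  trace-fixed e s {x} x-fixed = +-cancelˡ x _ _ (begin
    x + trace e s (x ^ (2 ℕ.^ e))               ≈⟨ trace-suc e s x ⟨
    trace e (suc s) x                           ≈⟨ trace-last e s x ⟩
    trace e s x + x ^ ((2 ℕ.^ e) ℕ.^ s)         ≈⟨ +-congˡ x-fixed ⟩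
    trace e s x + x                             ≈⟨ +-comm _ _ ⟩
    x + trace e s x                             ∎)

  trace-split : ∀ s t x → trace 1 (s ℕ.+ t) x ≈ trace 1 s x + trace 1 t (x ^ (2 ℕ.^ s))
  trace-split zero    t x = sym (trans (+-identityˡ _) (trace-cong 1 t (*-identityʳ x)))
  trace-split (suc s) t x = begin
    trace 1 (suc (s ℕ.+ t)) x                                       ≈⟨ trace-suc 1 (s ℕ.+ t) x ⟩
    x + trace 1 (s ℕ.+ t) (x ^ 2)                                   ≈⟨ +-congˡ (trace-split s t (x ^ 2)) ⟩
    x + (trace 1 s (x ^ 2) + trace 1 t ((x ^ 2) ^ (2 ℕ.^ s)))       ≈⟨ +-assoc _ _ _ ⟨
    x + trace 1 s (x ^ 2) + trace 1 t ((x ^ 2) ^ (2 ℕ.^ s))         ≈⟨ +-cong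
      (sym (trace-suc 1 s x)) (trace-cong 1 t (^-assocʳ x 2 (2 ℕ.^ s))) ⟩
    trace 1 (suc s) x + trace 1 t (x ^ (2 ℕ.^ suc s))               ∎

  -- Transitivity of the trace: the `s * e` successive squarings are cut into `s` blocks of length
  -- `e`.
  trace-tower : ∀ e s x → trace 1 (s ℕ.* e) x ≈ trace 1 e (trace e s x)
  trace-tower e zero    x = sym (Trace.φ-0 1 e)
  trace-tower e (suc s) x = begin
    trace 1 (e ℕ.+ s ℕ.* e) x                                       ≈⟨ trace-split e (s ℕ.* e) x ⟩
    trace 1 e x + trace 1 (s ℕ.* e) (x ^ (2 ℕ.^ e))                 ≈⟨ +-congˡ (trace-tower e s _) ⟩
    trace 1 e x + trace 1 e (trace e s (x ^ (2 ℕ.^ e)))             ≈⟨ trace-distrib-+ 1 e _ _ ⟨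
    trace 1 e (x + trace e s (x ^ (2 ℕ.^ e)))                       ≈⟨ trace-cong 1 e (trace-suc e s x) ⟨
    trace 1 e (trace e (suc s) x)                                   ∎

  -- The last term x^(2^s) dominates, since the preceding ones form a trace of degree below 2^s. The
  -- two statements feed each other. The degree 2^s is half of 2^(s+1), which leaves too few roots
  -- for the trace to vanish on a field of that size.
  trace-monic : ∀ s → Monic (2 ℕ.^ s) (trace 1 (suc s))
  trace-< : ∀ s → Polynomial< (2 ℕ.^ s) (trace 1 s)

  trace-monic s = Monic-cong (2 ℕ.^ s)
    (λ x → trans (+-comm _ _) (sym (trace-last 1 s x)))
    (monic+< (2 ℕ.^ s) (^-monic (2 ℕ.^ s)) (trace-< s))

  trace-< zero    = 0-< 1
  trace-< (suc s) = <-weaken (ℕ.^-monoʳ-< 2 (ℕ.s≤s (ℕ.s≤s ℕ.z≤n)) (ℕ.n<1+n s))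
    (monic⇒< (2 ℕ.^ s) (trace-monic s))

  -- Every term is 1 and their number is odd; the shape `1 + j * 2` lets pairs be cancelled by
  -- induction.
  trace-1 : ∀ e j → trace e (1 ℕ.+ j ℕ.* 2) 1# ≈ 1#
  trace-1 e zero    = trans (+-identityʳ _) (*-identityʳ 1#)
  trace-1 e (suc j) = begin
    trace e (3 ℕ.+ j ℕ.* 2) 1#                ≈⟨ trans (one-more (2 ℕ.+ j ℕ.* 2)) (+-congˡ (one-more (1 ℕ.+ j ℕ.* 2))) ⟩
    1# + (1# + trace e (1 ℕ.+ j ℕ.* 2) 1#)    ≈⟨ +-congˡ (+-congˡ (trace-1 e j)) ⟩
    1# + (1# + 1#)                            ≈⟨ solve 0 (con true :+ (con true :+ con true) := con true) refl ⟩
    1#                                        ∎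
    where
    one-more : ∀ s → trace e (suc s) 1# ≈ 1# + trace e s 1#
    one-more s = trans (trace-suc e s 1#) (+-congˡ (trace-cong e s (1^ (2 ℕ.^ e))))

-- The absolute trace, the relative trace and adjoints

module AbsoluteTrace {c ℓ} (m n : ℕ) (0<m : 0 < m) (n-odd : n % 2 ≡ 1)
                     (F : FiniteField c ℓ ((2 ℕ.^ m) ℕ.^ n)) where

  open Extension m n F
  open Exp semiring using (^-congˡ; ^-congʳ; ^-assocʳ)
  open CommutativeExp commutativeSemiring using (^-distrib-*)
  open FieldPowers F
  open Traces m n F
  open SemiringSum semiring using (sum-cong-≋; *-distribˡ-sum)
  open SetoidReasoning setoid

  tr : Carrier → Carrier
  tr = trace 1 (n ℕ.* m)

  tr-cong : Congruent _≈_ _≈_ tr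
  tr-cong = trace-cong 1 (n ℕ.* m)

  tr-+ : ∀ x y → tr (x + y) ≈ tr x + tr y
  tr-+ = trace-distrib-+ 1 (n ℕ.* m)

  tr-0 : tr 0# ≈ 0#
  tr-0 = Trace.φ-0 1 (n ℕ.* m)

  q^n≡2^nm : q ℕ.^ n ≡ 2 ℕ.^ (n ℕ.* m)
  q^n≡2^nm = ≡.trans (ℕ.^-*-assoc 2 m n) (≡.cong (2 ℕ.^_) (ℕ.*-comm m n))

  tr-^2 : ∀ x → tr (x ^ 2) ≈ tr x
  tr-^2 x = trace-fixed 1 (n ℕ.* m) (trans (^-congʳ x (≡.sym q^n≡2^nm)) (x^N≈x x))

  tr-^2^ : ∀ e x → tr (x ^ (2 ℕ.^ e)) ≈ tr x
  tr-^2^ zero    x = tr-cong (*-identityʳ x)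
  tr-^2^ (suc e) x = begin
    tr (x ^ (2 ℕ.* 2 ℕ.^ e))      ≈⟨ tr-cong (^-assocʳ x 2 (2 ℕ.^ e)) ⟨
    tr ((x ^ 2) ^ (2 ℕ.^ e))      ≈⟨ tr-^2^ e (x ^ 2) ⟩
    tr (x ^ 2)                    ≈⟨ tr-^2 x ⟩
    tr x                          ∎

  tr-^q^ : ∀ j x → tr (x ^ (q ℕ.^ j)) ≈ tr x
  tr-^q^ j x = trans (tr-cong (^-congʳ x (ℕ.^-*-assoc 2 m j))) (tr-^2^ (m ℕ.* j) x)

  -- The trace is fixed by squaring, so t * t ≈ t * 1, and a nonzero t cancels.
  tr≉0⇒tr≈1 : ∀ {x} → tr x ≉ 0# → tr x ≈ 1#
  tr≉0⇒tr≈1 {x} tr≉0 = *-cancelˡ tr≉0 (begin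
    tr x * tr x             ≈⟨ *-congˡ (*-identityʳ (tr x)) ⟨
    tr x ^ 2                ≈⟨ trace-^ 1 (n ℕ.* m) 1 x ⟩
    tr (x ^ 2)              ≈⟨ tr-^2 x ⟩
    tr x                    ≈⟨ *-identityʳ _ ⟨
    tr x * 1#               ∎)

  odd⇒1+half*2 : n ≡ 1 ℕ.+ n ℕ./ 2 ℕ.* 2
  odd⇒1+half*2 = ≡.trans (ℕ.m≡m%n+[m/n]*n n 2) (≡.cong (ℕ._+ n ℕ./ 2 ℕ.* 2) n-odd)

  -- The number of terms is a variable `d` so that it can be matched as a successor, which `n * m`
  -- does not allow.
  trace-nonvanishing : ∀ d → 0 < d → 2 ℕ.^ d ≡ q ℕ.^ n → ∃ λ x → trace 1 d x ≉ 0#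
  trace-nonvanishing (suc s) _ eq = monic-nonvanishing (2 ℕ.^ s) (trace-monic s) (trace-cong 1 (suc s))
    (≡.subst (2 ℕ.^ s <_) eq (ℕ.^-monoʳ-< 2 (ℕ.s≤s (ℕ.s≤s ℕ.z≤n)) (ℕ.n<1+n s)))

  0<nm : 0 < n ℕ.* m
  0<nm = ≡.subst (λ n → 0 < n ℕ.* m) (≡.sym odd⇒1+half*2) (ℕ.≤-trans 0<m (ℕ.m≤m+n m _))

  tr-surjective : ∃ λ w → tr w ≈ 1#
  tr-surjective with w , tr≉0 ← trace-nonvanishing (n ℕ.* m) 0<nm (≡.sym q^n≡2^nm) = w , tr≉0⇒tr≈1 tr≉0

  Tr-1 : Tr 1# ≈ 1#
  Tr-1 = ≡.subst (λ s → trace m s 1# ≈ 1#) (≡.sym odd⇒1+half*2) (trace-1 m (n ℕ./ 2))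

  Tr-cong : Congruent _≈_ _≈_ Tr
  Tr-cong = trace-cong m n

  Tr-1+ : ∀ b → Tr (1# + b) ≈ 1# + Tr b
  Tr-1+ b = trans (trace-distrib-+ m n 1# b) (+-congʳ Tr-1)

  Tr-^q : ∀ x → Tr x ^ q ≈ Tr x
  Tr-^q x = trans (trace-^ m n m x) (trace-fixed m n (x^N≈x x))

  fixed-^ : ∀ {x} a → x ^ a ≈ x → ∀ t → x ^ (a ℕ.^ t) ≈ x
  fixed-^ {x} a fixed zero    = *-identityʳ x
  fixed-^ {x} a fixed (suc t) = begin
    x ^ (a ℕ.* a ℕ.^ t)     ≈⟨ ^-assocʳ x a (a ℕ.^ t) ⟨
    (x ^ a) ^ (a ℕ.^ t)     ≈⟨ ^-congˡ (a ℕ.^ t) fixed ⟩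
    x ^ (a ℕ.^ t)           ≈⟨ fixed-^ a fixed t ⟩
    x                       ∎

  Tr-*ˡ : ∀ {r} → r ^ q ≈ r → ∀ z → Tr (r * z) ≈ r * Tr z
  Tr-*ˡ {r} r-fixed z = trans
    (sum-cong-≋ {n} (λ i → trans (^-distrib-* r z (q ℕ.^ toℕ i)) (*-congʳ (fixed-^ q r-fixed (toℕ i)))))
    (sym (*-distribˡ-sum {n} r (λ i → z ^ (q ℕ.^ toℕ i))))

  tr-*ˡ : ∀ {r} → r ^ q ≈ r → ∀ z → tr (r * z) ≈ trace 1 m (r * Tr z)
  tr-*ˡ r-fixed z = trans (trace-tower m n _) (trace-cong 1 m (Tr-*ˡ r-fixed z))

  -- Since Tr z lies in the field with q elements, so does r = Tr w / Tr z, where tr w ≈ 1. By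
  -- linearity Tr (r z) ≈ Tr w, and transitivity of the trace brings tr (r z) to tr w.
  Tr≉0⇒separated : ∀ {z} → Tr z ≉ 0# → ∃ λ r → r ^ q ≈ r × tr (r * z) ≈ 1#
  Tr≉0⇒separated {z} t≉0 with w , tr-w ← tr-surjective =
    Tr w * t⁻¹ , r-fixed , (begin
      tr (Tr w * t⁻¹ * z)                   ≈⟨ tr-*ˡ r-fixed z ⟩
      trace 1 m (Tr w * t⁻¹ * Tr z)         ≈⟨ trace-cong 1 m (*-assoc _ _ _) ⟩
      trace 1 m (Tr w * (t⁻¹ * Tr z))       ≈⟨ trace-cong 1 m (*-congˡ (⁻¹-inverseˡ t≉0)) ⟩
      trace 1 m (Tr w * 1#)                 ≈⟨ trace-cong 1 m (*-identityʳ _) ⟩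
      trace 1 m (Tr w)                      ≈⟨ trace-tower m n w ⟨
      tr w                                  ≈⟨ tr-w ⟩
      1#                                    ∎)
    where
    t⁻¹ = t≉0 ⁻¹
    t⁻¹-fixed : t⁻¹ ^ q ≈ t⁻¹
    t⁻¹-fixed = *-cancelˡ t≉0 (begin
      Tr z * t⁻¹ ^ q             ≈⟨ *-congʳ (Tr-^q z) ⟨
      Tr z ^ q * t⁻¹ ^ q         ≈⟨ ^-distrib-* (Tr z) t⁻¹ q ⟨
      (Tr z * t⁻¹) ^ q           ≈⟨ ^-congˡ q (⁻¹-inverseʳ t≉0) ⟩
      1# ^ q                     ≈⟨ 1^ q ⟩
      1#                         ≈⟨ ⁻¹-inverseʳ t≉0 ⟨
      Tr z * t⁻¹                 ∎)
    r-fixed : (Tr w * t⁻¹) ^ q ≈ Tr w * t⁻¹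
    r-fixed = trans (^-distrib-* (Tr w) t⁻¹ q) (*-cong (Tr-^q w) t⁻¹-fixed)

  √-^2 : ∀ x → √ x ^ 2 ≈ x
  √-^2 = Inverse.strictlyInverseˡ (Bijection⇒Inverse frobenius)

  iterate-√-^ : ∀ x e → iterate √ x e ^ (2 ℕ.^ e) ≈ x
  iterate-√-^ x zero    = *-identityʳ x
  iterate-√-^ x (suc e) = begin
    iterate √ (√ x) e ^ (2 ℕ.* 2 ℕ.^ e)      ≈⟨ ^-assocʳ _ 2 (2 ℕ.^ e) ⟨
    (iterate √ (√ x) e ^ 2) ^ (2 ℕ.^ e)      ≈⟨ ^-comm _ 2 (2 ℕ.^ e) ⟩
    (iterate √ (√ x) e ^ (2 ℕ.^ e)) ^ 2      ≈⟨ ^-congˡ 2 (iterate-√-^ (√ x) e) ⟩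
    √ x ^ 2                                  ≈⟨ √-^2 x ⟩
    x                                        ∎

  -- Term by term: the factor b y is the 2^e-th power of its iterated root, so the whole term is a
  -- 2^e-th power, which the absolute trace does not see.
  linear-adjoint : ∀ {d} (a : Vector Carrier d) x y → tr (y * linear a x) ≈ tr (x * linear′ a y)
  linear-adjoint {d} a x y = begin
    tr (y * linear a x)                                          ≈⟨ tr-cong (*-distribˡ-sum {d} y (λ i → a i * x ^ (2 ℕ.^ toℕ i))) ⟩
    tr (∑[ i < d ] (y * (a i * x ^ (2 ℕ.^ toℕ i))))              ≈⟨ Trace.φ-sum 1 (n ℕ.* m) {d} (λ i → y * (a i * x ^ (2 ℕ.^ toℕ i))) ⟩
    ∑[ i < d ] tr (y * (a i * x ^ (2 ℕ.^ toℕ i)))                ≈⟨ sum-cong-≋ {d} (λ i → term (a i) (toℕ i)) ⟩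
    ∑[ i < d ] tr (x * iterate √ (a i * y) (toℕ i))              ≈⟨ Trace.φ-sum 1 (n ℕ.* m) {d} (λ i → x * iterate √ (a i * y) (toℕ i)) ⟨
    tr (∑[ i < d ] (x * iterate √ (a i * y) (toℕ i)))            ≈⟨ tr-cong (*-distribˡ-sum {d} x (λ i → iterate √ (a i * y) (toℕ i))) ⟨
    tr (x * linear′ a y)                                         ∎
    where
    term : ∀ b e → tr (y * (b * x ^ (2 ℕ.^ e))) ≈ tr (x * iterate √ (b * y) e)
    term b e = begin
      tr (y * (b * x ^ (2 ℕ.^ e)))                               ≈⟨ tr-cong (solve 3 (λ b y z → y :* (b :* z) := z :* (b :* y)) refl b y (x ^ (2 ℕ.^ e))) ⟩
      tr (x ^ (2 ℕ.^ e) * (b * y))                               ≈⟨ tr-cong (*-congˡ (iterate-√-^ (b * y) e)) ⟨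
      tr (x ^ (2 ℕ.^ e) * iterate √ (b * y) e ^ (2 ℕ.^ e))       ≈⟨ tr-cong (^-distrib-* x _ (2 ℕ.^ e)) ⟨
      tr ((x * iterate √ (b * y) e) ^ (2 ℕ.^ e))                 ≈⟨ tr-^2^ e _ ⟩
      tr (x * iterate √ (b * y) e)                               ∎

-- Integer sums over the field: positivity and cancellation

module IntegerSum {c ℓ N} (F : FiniteField c ℓ N) where

  open FiniteField F
  open FieldSum F ℤ.+-0-commutativeMonoid public
  open SemiringSum (CommutativeRing.semiring ℤ.+-*-commutativeRing) using (sum; sum-remove; *-distribˡ-sum)
  private module E = Inverse enumeration

  ∑F-*ˡ : ∀ a (h : Carrier → ℤ) → ∑F (λ x → a ℤ.* h x) ≡ a ℤ.* ∑F h
  ∑F-*ˡ a h = ≡.sym (*-distribˡ-sum a (λ i → h (E.to i)))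

  sum-nonneg : ∀ {s} (t : Fin s → ℤ) → (∀ i → ℤ.0ℤ ℤ.≤ t i) → ℤ.0ℤ ℤ.≤ sum t
  sum-nonneg {zero}  t 0≤t = ℤ.≤-refl
  sum-nonneg {suc s} t 0≤t = ℤ.+-mono-≤ (0≤t Fin.zero) (sum-nonneg _ (λ i → 0≤t (Fin.suc i)))

  sum-pos : ∀ {s} (t : Fin s → ℤ) → (∀ i → ℤ.0ℤ ℤ.≤ t i) → ∀ i → ℤ.0ℤ ℤ.< t i → ℤ.0ℤ ℤ.< sum t
  sum-pos {suc s} t 0≤t i 0<ti = ≡.subst (ℤ.0ℤ ℤ.<_) (≡.sym (sum-remove {i = i} t))
    (ℤ.+-mono-<-≤ 0<ti (sum-nonneg _ (λ j → 0≤t (Fin.punchIn i j))))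

  ∑F-pos : ∀ {h} → Congruent _≈_ _≡_ h → (∀ x → ℤ.0ℤ ℤ.≤ h x) → ∀ a → ℤ.0ℤ ℤ.< h a → ℤ.0ℤ ℤ.< ∑F h
  ∑F-pos {h} h-cong 0≤h a 0<ha = sum-pos (λ i → h (E.to i)) (λ i → 0≤h _) (E.from a)
    (≡.subst (ℤ.0ℤ ℤ.<_) (h-cong (sym (E.strictlyInverseˡ a))) 0<ha)

  -- One point of the support is enough, its size is not. The supports in question are {0} and the
  -- radical of the quadratic form.
  ∑F-pos-on : ∀ {h} → Congruent _≈_ _≡_ h → ∀ {p} {P : Carrier → Set p} → (∀ x → Dec (P x)) →
              (∀ {x} → P x → ℤ.0ℤ ℤ.< h x) → (∀ {x} → ¬ P x → h x ≡ ℤ.0ℤ) → ∀ {a} → P a → ℤ.0ℤ ℤ.< ∑F h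
  ∑F-pos-on {h} h-cong {P = P} P? pos vanish {a} Pa = ∑F-pos h-cong (λ x → nonneg (P? x)) a (pos Pa)
    where
    nonneg : ∀ {x} → Dec (P x) → ℤ.0ℤ ℤ.≤ h x
    nonneg (yes Px) = ℤ.<⇒≤ (pos Px)
    nonneg (no ¬Px) = ℤ.≤-reflexive (≡.sym (vanish ¬Px))

  ∑F-1>0 : ∀ {h} → (∀ x → h x ≡ ℤ.1ℤ) → ℤ.0ℤ ℤ.< ∑F h
  ∑F-1>0 {h} h≡1 = ∑F-pos (λ {x} {y} _ → ≡.trans (h≡1 x) (≡.sym (h≡1 y)))
    (λ x → ≡.subst (ℤ.0ℤ ℤ.≤_) (≡.sym (h≡1 x)) (ℤ.+≤+ ℕ.z≤n)) 0#
    (≡.subst (ℤ.0ℤ ℤ.<_) (≡.sym (h≡1 0#)) (ℤ.+<+ (ℕ.s≤s ℕ.z≤n)))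

  self-negative : ∀ i → i ≡ ℤ.- i → i ≡ ℤ.0ℤ
  self-negative (+ zero)  _ = ≡.refl
  self-negative (+ suc _) ()
  self-negative -[1+ _ ]  ()

  -- Translation permutes the field, so the sum equals its own negative, and ℤ has no 2-torsion.
  -- Both orthogonality and the vanishing of the quadratic sum come from here.
  ∑F-antisymmetric : ∀ {h} → Congruent _≈_ _≡_ h → ∀ a → (∀ x → h (x + a) ≡ ℤ.- h x) → ∑F h ≡ ℤ.0ℤ
  ∑F-antisymmetric {h} h-cong a anti = self-negative (∑F h) (begin
    ∑F h                              ≡⟨ ∑F-reindex h-cong (_+ a) +-congʳ (λ {x} {y} → +-cancelʳ a x y) ⟨
    ∑F (λ x → h (x + a))              ≡⟨ ∑F-cong (λ x → ≡.trans (anti x) (≡.sym (ℤ.-1*i≡-i (h x)))) ⟩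
    ∑F (λ x → ℤ.-1ℤ ℤ.* h x)          ≡⟨ ∑F-*ˡ ℤ.-1ℤ h ⟩
    ℤ.-1ℤ ℤ.* ∑F h                    ≡⟨ ℤ.-1*i≡-i (∑F h) ⟩
    ℤ.- ∑F h                          ∎)
    where
    open ≡.≡-Reasoning
    open RingProperties ring using (+-cancelʳ)

-- Additive characters and their sums

module Characters {c ℓ} (m n : ℕ) (0<m : 0 < m) (n-odd : n % 2 ≡ 1)
                  (F : FiniteField c ℓ ((2 ℕ.^ m) ℕ.^ n)) where

  open Extension m n F
  open FieldMaps F
  open FieldPowers F
  open Traces m n F
  open AbsoluteTrace m n 0<m n-odd F
  open IntegerSum F

  -- Total on the field although it is meant for the trace values 0 and 1, so that no proof of
  -- membership in the prime field is carried along.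
  sign : Carrier → ℤ
  sign y with y ≟ 0#
  ... | yes _ = ℤ.1ℤ
  ... | no  _ = ℤ.-1ℤ

  sign-0 : ∀ {y} → y ≈ 0# → sign y ≡ ℤ.1ℤ
  sign-0 {y} y≈0 with y ≟ 0#
  ... | yes _   = ≡.refl
  ... | no  y≉0 = ⊥-elim (y≉0 y≈0)

  sign-≉0 : ∀ {y} → y ≉ 0# → sign y ≡ ℤ.-1ℤ
  sign-≉0 {y} y≉0 with y ≟ 0#
  ... | yes y≈0 = ⊥-elim (y≉0 y≈0)
  ... | no  _   = ≡.refl

  sign-cong : Congruent _≈_ _≡_ sign
  sign-cong {x} {y} x≈y with x ≟ 0#
  ... | yes x≈0 = ≡.sym (sign-0 (trans (sym x≈y) x≈0))
  ... | no  x≉0 = ≡.sym (sign-≉0 (λ y≈0 → x≉0 (trans x≈y y≈0)))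

  χ : Carrier → ℤ
  χ x = sign (tr x)

  χ-cong : Congruent _≈_ _≡_ χ
  χ-cong x≈y = sign-cong (tr-cong x≈y)

  χ-0 : ∀ {x} → tr x ≈ 0# → χ x ≡ ℤ.1ℤ
  χ-0 = sign-0

  χ-1 : ∀ {x} → tr x ≈ 1# → χ x ≡ ℤ.-1ℤ
  χ-1 eq = sign-≉0 (λ tr≈0 → 0≉1 (trans (sym tr≈0) eq))

  -- The hypothesis compares traces instead of elements, because the polarisation identity of the
  -- quadratic form holds only after taking traces.
  χ-* : ∀ {x y z} → tr z ≈ tr x + tr y → χ z ≡ χ x ℤ.* χ y
  χ-* {x} {y} {z} eq with tr x ≟ 0# | tr y ≟ 0#
  ... | yes x≈0 | yes y≈0 = χ-0 (trans eq (trans (+-cong x≈0 y≈0) (+-identityˡ 0#)))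
  ... | yes x≈0 | no  y≉0 = χ-1 (trans eq (trans (+-cong x≈0 (tr≉0⇒tr≈1 y≉0)) (+-identityˡ 1#)))
  ... | no  x≉0 | yes y≈0 = χ-1 (trans eq (trans (+-cong (tr≉0⇒tr≈1 x≉0) y≈0) (+-identityʳ 1#)))
  ... | no  x≉0 | no  y≉0 = χ-0 (trans eq (trans (+-cong (tr≉0⇒tr≈1 x≉0) (tr≉0⇒tr≈1 y≉0)) (x+x≈0 1#)))

  χ-negate : ∀ {x y} → tr y ≈ tr x + 1# → χ y ≡ ℤ.- χ x
  χ-negate {x} {y} eq with tr x ≟ 0#
  ... | yes x≈0 = χ-1 (trans eq (trans (+-congʳ x≈0) (+-identityˡ 1#)))
  ... | no  x≉0 = χ-0 (trans eq (trans (+-congʳ (tr≉0⇒tr≈1 x≉0)) (x+x≈0 1#)))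

  χ-square : ∀ x → χ x ℤ.* χ x ≡ ℤ.1ℤ
  χ-square x = ≡.trans (≡.sym (χ-* {x} {x} {0#} (trans tr-0 (sym (x+x≈0 _))))) (χ-0 tr-0)

  -- Moving z by v / w, with tr v ≈ 1, adds 1 to the trace and so reverses every sign.
  ∑χ-orthogonal : ∀ {w} → w ≉ 0# → ∑F (λ z → χ (z * w)) ≡ ℤ.0ℤ
  ∑χ-orthogonal {w} w≉0 = ∑F-antisymmetric (λ eq → χ-cong (*-congʳ eq)) (v * (w≉0 ⁻¹)) λ z →
    χ-negate (trans (tr-cong (shift z)) (trans (tr-+ _ _) (+-congˡ (proj₂ tr-surjective))))
    where
    v : Carrier
    v = proj₁ tr-surjective
    shift : ∀ z → (z + v * (w≉0 ⁻¹)) * w ≈ z * w + v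
    shift z = trans (distribʳ w z _) (+-congˡ (trans (*-assoc v _ w)
      (trans (*-congˡ (⁻¹-inverseˡ w≉0)) (*-identityʳ v))))

  ∑χ-trivial : ∀ {w} → w ≈ 0# → ℤ.0ℤ ℤ.< ∑F (λ z → χ (z * w))
  ∑χ-trivial w≈0 = ∑F-1>0 (λ z → χ-0 (trans (tr-cong (trans (*-congˡ w≈0) (zeroʳ z))) tr-0))

  module _ {f : Carrier → Carrier} (f-cong : Congruent _≈_ _≈_ f) where

    injective⇒balanced : Injective _≈_ _≈_ f → ∀ {u} → u ≉ 0# → ∑F (λ x → χ (f x * u)) ≡ ℤ.0ℤ
    injective⇒balanced f-inj u≉0 = ≡.trans
      (∑F-reindex (λ eq → χ-cong (*-congʳ eq)) f f-cong f-inj)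
      (∑χ-orthogonal u≉0)

    -- If f omits y, then ∑ᵤ ∑ₓ χ(u (f(x) + y)) vanishes by orthogonality in u,
    -- although only its positive term u = 0 survives the sum over x.
    balanced⇒surjective : (∀ {u} → u ≉ 0# → ∑F (λ x → χ (f x * u)) ≡ ℤ.0ℤ) → ∀ y → ∃ λ x → f x ≈ y
    balanced⇒surjective balanced y with hit? f f-cong y
    ... | yes hit  = hit
    ... | no  miss = ⊥-elim (ℤ.<-irrefl (≡.sym total≡0) total>0)
      where
      inner : Carrier → ℤ
      inner u = ∑F (λ x → χ (u * (f x + y)))
      total≡0 : ∑F inner ≡ ℤ.0ℤ
      total≡0 = ≡.trans (∑F-comm (λ u x → χ (u * (f x + y))))
        (∑F-ε (λ x → ∑χ-orthogonal (λ eq → miss (x , x+y≈0⇒x≈y eq))))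
      inner-cong : Congruent _≈_ _≡_ inner
      inner-cong eq = ∑F-cong (λ x → χ-cong (*-congʳ {f x + y} eq))
      inner-0 : ∀ {u} → u ≈ 0# → ℤ.0ℤ ℤ.< inner u
      inner-0 u≈0 = ∑F-1>0 (λ x → χ-0 (trans (tr-cong (trans (*-congʳ {f x + y} u≈0) (zeroˡ _))) tr-0))
      inner-≉0 : ∀ {u} → u ≉ 0# → inner u ≡ ℤ.0ℤ
      inner-≉0 {u} u≉0 = ≡.trans
        (∑F-cong (λ x → χ-* {u * y} {f x * u} {u * (f x + y)} (trans
          (tr-cong (solve 3 (λ u z y → u :* (z :+ y) := u :* y :+ z :* u) refl u (f x) y)) (tr-+ _ _))))
        (≡.trans (∑F-*ˡ (χ (u * y)) (λ x → χ (f x * u)))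
          (≡.trans (≡.cong (χ (u * y) ℤ.*_) (balanced u≉0)) (ℤ.*-zeroʳ (χ (u * y)))))
      total>0 : ℤ.0ℤ ℤ.< ∑F inner
      total>0 = ∑F-pos-on inner-cong (_≟ 0#) inner-0 inner-≉0 refl

  -- Here `w` is the polar form of `g`. In the double sum over x and x + y the two values χ (g x)
  -- cancel, being signs, which leaves a sum over x of the polar form alone.
  ∑χ-square : ∀ {g : Carrier → Carrier} {w : Carrier → Carrier → Carrier} → Congruent _≈_ _≈_ g →
              (∀ x y → tr (g (x + y)) ≈ tr (g x) + (tr (g y) + tr (w x y))) →
              ∑F (λ x → χ (g x)) ℤ.* ∑F (λ x → χ (g x)) ≡ ∑F (λ y → χ (g y) ℤ.* ∑F (λ x → χ (w x y)))
  ∑χ-square {g} {w} g-cong expand = begin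
    T ℤ.* T                                             ≡⟨ ∑F-*ˡ T (λ x → χ (g x)) ⟨
    ∑F (λ x → T ℤ.* χ (g x))                            ≡⟨ ∑F-cong (λ x → ≡.trans (ℤ.*-comm T (χ (g x))) (row x)) ⟩
    ∑F (λ x → ∑F (λ y → χ (g y) ℤ.* χ (w x y)))         ≡⟨ ∑F-comm (λ x y → χ (g y) ℤ.* χ (w x y)) ⟩
    ∑F (λ y → ∑F (λ x → χ (g y) ℤ.* χ (w x y)))         ≡⟨ ∑F-cong (λ y → ∑F-*ˡ (χ (g y)) (λ x → χ (w x y))) ⟩
    ∑F (λ y → χ (g y) ℤ.* ∑F (λ x → χ (w x y)))         ∎
    where
    open ≡.≡-Reasoning
    open RingProperties ring using (+-cancelˡ)
    T : ℤ
    T = ∑F (λ x → χ (g x))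
    cell : ∀ x y → χ (g x) ℤ.* χ (g (x + y)) ≡ χ (g y) ℤ.* χ (w x y)
    cell x y = begin
      χ (g x) ℤ.* χ (g (x + y))                    ≡⟨ ≡.cong (χ (g x) ℤ.*_)
        (χ-* {g x} {g y + w x y} (trans (expand x y) (+-congˡ (sym (tr-+ _ _))))) ⟩
      χ (g x) ℤ.* (χ (g x) ℤ.* χ (g y + w x y))    ≡⟨ ℤ.*-assoc (χ (g x)) (χ (g x)) (χ (g y + w x y)) ⟨
      χ (g x) ℤ.* χ (g x) ℤ.* χ (g y + w x y)      ≡⟨ ≡.cong (ℤ._* χ (g y + w x y)) (χ-square (g x)) ⟩
      ℤ.1ℤ ℤ.* χ (g y + w x y)                     ≡⟨ ℤ.*-identityˡ (χ (g y + w x y)) ⟩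
      χ (g y + w x y)                              ≡⟨ χ-* {g y} {w x y} (tr-+ _ _) ⟩
      χ (g y) ℤ.* χ (w x y)                        ∎
    row : ∀ x → χ (g x) ℤ.* T ≡ ∑F (λ y → χ (g y) ℤ.* χ (w x y))
    row x = begin
      χ (g x) ℤ.* T                                ≡⟨ ≡.cong (χ (g x) ℤ.*_)
        (∑F-reindex (λ eq → χ-cong (g-cong eq)) (λ y → x + y) +-congˡ (λ {y} {z} → +-cancelˡ x y z)) ⟨
      χ (g x) ℤ.* ∑F (λ y → χ (g (x + y)))         ≡⟨ ∑F-*ˡ (χ (g x)) (λ y → χ (g (x + y))) ⟨
      ∑F (λ y → χ (g x) ℤ.* χ (g (x + y)))         ≡⟨ ∑F-cong (cell x) ⟩
      ∑F (λ y → χ (g y) ℤ.* χ (w x y))             ∎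

-- A common divisor of 2k and n is odd because n is, hence it divides k.
odd∧coprime⇒coprime-2* : ∀ {k n} → n % 2 ≡ 1 → Coprime k n → Coprime (2 ℕ.* k) n
odd∧coprime⇒coprime-2* {k} {n} n-odd coprime {d} (d∣2k , d∣n) =
  coprime (coprime-divisor {d} {2} {k} d-coprime-2 d∣2k , d∣n)
  where
  d-coprime-2 : Coprime d 2
  d-coprime-2 {e} (e∣d , e∣2) with prime⇒irreducible prime[2] e∣2
  ... | inj₁ e≡1    = e≡1
  ... | inj₂ ≡.refl with () ← ≡.trans (≡.sym n-odd) (n∣m⇒m%n≡0 n 2 (∣-trans e∣d d∣n))

-- Fixed points of Frobenius powers and the (Q+1)-th power map

module Quadratic {c ℓ} (m n k : ℕ) (0<m : 0 < m) (n-odd : n % 2 ≡ 1) (k-coprime-n : Coprime k n)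
                 (F : FiniteField c ℓ ((2 ℕ.^ m) ℕ.^ n)) where

  open Extension m n F
  open Exp semiring using (^-congˡ; ^-congʳ; ^-homo-*; ^-assocʳ)
  open CommutativeExp commutativeSemiring using (^-distrib-*)
  open FieldMaps F
  open FieldPowers F
  open Traces m n F
  open AbsoluteTrace m n 0<m n-odd F
  open IntegerSum F
  open Characters m n 0<m n-odd F
  open SetoidReasoning setoid

  Q : ℕ
  Q = q ℕ.^ k

  multiple-fixed : ∀ {x} i j → x ^ (q ℕ.^ i) ≈ x → x ^ (q ℕ.^ (j ℕ.* i)) ≈ x
  multiple-fixed {x} i j fixed = trans
    (^-congʳ x (≡.trans (≡.cong (q ℕ.^_) (ℕ.*-comm j i)) (≡.sym (ℕ.^-*-assoc q i j))))
    (fixed-^ (q ℕ.^ i) fixed j)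

  -- This replaces negative powers of Frobenius: Bézout's identity over ℕ yields two multiples that
  -- differ by 1, and applying x ↦ x^q to the smaller relation reaches the larger.
  consecutive-fixed : ∀ {x} a b → 1 ℕ.+ a ≡ b → x ^ (q ℕ.^ a) ≈ x → x ^ (q ℕ.^ b) ≈ x → x ^ q ≈ x
  consecutive-fixed {x} a .(suc a) ≡.refl a-fixed b-fixed = begin
    x ^ q                         ≈⟨ ^-congˡ q a-fixed ⟨
    (x ^ (q ℕ.^ a)) ^ q           ≈⟨ ^-comm x (q ℕ.^ a) q ⟩
    (x ^ q) ^ (q ℕ.^ a)           ≈⟨ ^-assocʳ x q (q ℕ.^ a) ⟩
    x ^ (q ℕ.^ suc a)             ≈⟨ b-fixed ⟩
    x                             ∎

  coprime-fixed : ∀ {i j x} → Coprime i j → x ^ (q ℕ.^ i) ≈ x → x ^ (q ℕ.^ j) ≈ x → x ^ q ≈ x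
  coprime-fixed {i} {j} i-coprime-j i-fixed j-fixed with coprime-Bézout i-coprime-j
  ... | Bézout.+- s t eq = consecutive-fixed (t ℕ.* j) (s ℕ.* i) eq (multiple-fixed j t j-fixed) (multiple-fixed i s i-fixed)
  ... | Bézout.-+ s t eq = consecutive-fixed (s ℕ.* i) (t ℕ.* j) eq (multiple-fixed i s i-fixed) (multiple-fixed j t j-fixed)

  -- `x` is fixed by the 2k-th and by the n-th power of x ↦ x^q, and these exponents are coprime.
  QQ-fixed⇒q-fixed : ∀ {x} → (x ^ Q) ^ Q ≈ x → x ^ q ≈ x
  QQ-fixed⇒q-fixed {x} fixed = coprime-fixed {2 ℕ.* k} {n}
    (odd∧coprime⇒coprime-2* n-odd k-coprime-n)
    (trans (^-congʳ x q^2k≡QQ) (trans (sym (^-assocʳ x Q Q)) fixed)) (x^N≈x x)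
    where
    q^2k≡QQ : q ℕ.^ (2 ℕ.* k) ≡ Q ℕ.* Q
    q^2k≡QQ = ≡.trans (≡.cong (λ j → q ℕ.^ (k ℕ.+ j)) (ℕ.+-identityʳ k)) (ℕ.^-distribˡ-+-* q k k)

  ^Q-cong : Congruent _≈_ _≈_ (_^ Q)
  ^Q-cong = ^-congˡ Q

  ^Q-distrib-+ : ∀ x y → (x + y) ^ Q ≈ x ^ Q + y ^ Q
  ^Q-distrib-+ x y rewrite ℕ.^-*-assoc 2 m k = ^2^-distrib-+ (m ℕ.* k) x y

  x^[Q+1] : ∀ x → x ^ (Q ℕ.+ 1) ≈ x ^ Q * x
  x^[Q+1] x = trans (^-homo-* x Q 1) (*-congˡ (*-identityʳ x))

  ^-reflects-0 : ∀ {x} e → x ^ e ≈ 0# → x ≈ 0#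
  ^-reflects-0 {x} e x^e≈0 with x ≟ 0#
  ... | yes x≈0 = x≈0
  ... | no  x≉0 = ⊥-elim (^-≉0 x≉0 e x^e≈0)

  ^Q-injective : Injective _≈_ _≈_ (_^ Q)
  ^Q-injective {x} {y} eq = x+y≈0⇒x≈y (^-reflects-0 Q
    (trans (^Q-distrib-+ x y) (trans (+-congʳ eq) (x+x≈0 _))))

  ^2-injective : Injective _≈_ _≈_ (_^ 2)
  ^2-injective = proj₁ (Bijection.bijective frobenius)

  -- If w^(Q+1) = 1 then w^(Q²) = w, so w lies in the field with q elements and w² = 1.
  ^[Q+1]-kernel : ∀ {w} → w ^ (Q ℕ.+ 1) ≈ 1# → w ≈ 1#
  ^[Q+1]-kernel {w} eq = ^2-injective (begin
    w ^ 2              ≈⟨ *-congˡ (*-identityʳ w) ⟩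
    w * w              ≈⟨ *-congʳ (fixed-^ q w-fixed k) ⟨
    w ^ Q * w          ≈⟨ w^Q*w≈1 ⟩
    1#                 ≈⟨ 1^ 2 ⟨
    1# ^ 2             ∎)
    where
    w^Q*w≈1 : w ^ Q * w ≈ 1#
    w^Q*w≈1 = trans (sym (x^[Q+1] w)) eq
    w^Q≉0 : w ^ Q ≉ 0#
    w^Q≉0 w^Q≈0 = 0≉1 (trans (sym (zeroˡ w)) (trans (*-congʳ (sym w^Q≈0)) w^Q*w≈1))
    w-fixed : w ^ q ≈ w
    -- The Q-th power of w^Q w ≈ 1 reads w^(Q²) w^Q ≈ 1; comparing the two and cancelling w^Q gives
    -- w^(Q²) ≈ w.
    w-fixed = QQ-fixed⇒q-fixed (*-cancelˡ w^Q≉0 (begin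
      w ^ Q * (w ^ Q) ^ Q        ≈⟨ *-comm _ _ ⟩
      (w ^ Q) ^ Q * w ^ Q        ≈⟨ ^-distrib-* (w ^ Q) w Q ⟨
      (w ^ Q * w) ^ Q            ≈⟨ ^-congˡ Q w^Q*w≈1 ⟩
      1# ^ Q                     ≈⟨ 1^ Q ⟩
      1#                         ≈⟨ w^Q*w≈1 ⟨
      w ^ Q * w                  ∎))

  ^[Q+1]-injective : Injective _≈_ _≈_ (_^ (Q ℕ.+ 1))
  ^[Q+1]-injective {x} {y} eq with y ≟ 0#
  ... | yes y≈0 = trans (^-reflects-0 (Q ℕ.+ 1)
          (trans eq (trans (^-congˡ (Q ℕ.+ 1) y≈0) (trans (x^[Q+1] 0#) (zeroʳ _))))) (sym y≈0)
  ... | no  y≉0 = begin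
    x                        ≈⟨ *-identityʳ x ⟨
    x * 1#                   ≈⟨ *-congˡ (⁻¹-inverseˡ y≉0) ⟨
    x * (y⁻¹ * y)            ≈⟨ *-assoc x y⁻¹ y ⟨
    x * y⁻¹ * y              ≈⟨ *-congʳ (^[Q+1]-kernel (begin
      (x * y⁻¹) ^ (Q ℕ.+ 1)                  ≈⟨ ^-distrib-* x y⁻¹ (Q ℕ.+ 1) ⟩
      x ^ (Q ℕ.+ 1) * y⁻¹ ^ (Q ℕ.+ 1)        ≈⟨ *-congʳ eq ⟩
      y ^ (Q ℕ.+ 1) * y⁻¹ ^ (Q ℕ.+ 1)        ≈⟨ ^-distrib-* y y⁻¹ (Q ℕ.+ 1) ⟨
      (y * y⁻¹) ^ (Q ℕ.+ 1)                  ≈⟨ ^-congˡ (Q ℕ.+ 1) (⁻¹-inverseʳ y≉0) ⟩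
      1# ^ (Q ℕ.+ 1)                         ≈⟨ 1^ (Q ℕ.+ 1) ⟩
      1#                                     ∎)) ⟩
    1# * y                   ≈⟨ *-identityˡ y ⟩
    y                        ∎
    where y⁻¹ = y≉0 ⁻¹

  -- The character sum of the quadratic form

  module _ (b : Carrier) where

    g : Carrier → Carrier
    g x = x ^ (Q ℕ.+ 1) + b * x ^ 2

    g-cong : Congruent _≈_ _≈_ g
    g-cong eq = +-cong (^-congˡ (Q ℕ.+ 1) eq) (*-congˡ (^-congˡ 2 eq))

    -- The term b x² is additive, so `b` drops out of the polar form. Raising x y^Q to the power Q
    -- under the trace makes x^Q a common factor, so that for fixed y the form is linear in x^Q.
    tr-g-+ : ∀ x y → tr (g (x + y)) ≈ tr (g x) + (tr (g y) + tr (x ^ Q * (y + (y ^ Q) ^ Q)))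
    tr-g-+ x y = begin
      tr (g (x + y))
        ≈⟨ tr-cong (+-congʳ (trans (x^[Q+1] (x + y)) (*-congʳ (^Q-distrib-+ x y)))) ⟩
      tr ((x ^ Q + y ^ Q) * (x + y) + b * (x + y) ^ 2)
        ≈⟨ tr-cong (solve 5 (λ b x y X Y →
             (X :+ Y) :* (x :+ y) :+ b :* ((x :+ y) :* ((x :+ y) :* con true)) :=
             (X :* x :+ b :* (x :* (x :* con true))) :+ ((Y :* y :+ b :* (y :* (y :* con true))) :+ (X :* y :+ x :* Y)))
             refl b x y (x ^ Q) (y ^ Q)) ⟩
      tr ((x ^ Q * x + b * x ^ 2) + ((y ^ Q * y + b * y ^ 2) + (x ^ Q * y + x * y ^ Q)))
        ≈⟨ trans (tr-+ _ _) (+-congˡ (tr-+ _ _)) ⟩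
      tr (x ^ Q * x + b * x ^ 2) + (tr (y ^ Q * y + b * y ^ 2) + tr (x ^ Q * y + x * y ^ Q))
        ≈⟨ +-cong (tr-cong (+-congʳ (sym (x^[Q+1] x)))) (+-cong (tr-cong (+-congʳ (sym (x^[Q+1] y)))) polar) ⟩
      tr (g x) + (tr (g y) + tr (x ^ Q * (y + (y ^ Q) ^ Q)))
        ∎
      where
      polar : tr (x ^ Q * y + x * y ^ Q) ≈ tr (x ^ Q * (y + (y ^ Q) ^ Q))
      polar = begin
        tr (x ^ Q * y + x * y ^ Q)                      ≈⟨ tr-+ _ _ ⟩
        tr (x ^ Q * y) + tr (x * y ^ Q)                 ≈⟨ +-congˡ (tr-^q^ k _) ⟨
        tr (x ^ Q * y) + tr ((x * y ^ Q) ^ Q)           ≈⟨ +-congˡ (tr-cong (^-distrib-* x (y ^ Q) Q)) ⟩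
        tr (x ^ Q * y) + tr (x ^ Q * (y ^ Q) ^ Q)       ≈⟨ tr-+ _ _ ⟨
        tr (x ^ Q * y + x ^ Q * (y ^ Q) ^ Q)            ≈⟨ tr-cong (distribˡ _ _ _) ⟨
        tr (x ^ Q * (y + (y ^ Q) ^ Q))                  ∎

    g-radical : ∀ {y} → y ^ q ≈ y → g y ≈ y * y * (1# + b)
    g-radical {y} fixed = trans (+-congʳ (trans (x^[Q+1] y) (*-congʳ (fixed-^ q fixed k))))
      (solve 2 (λ b y → y :* y :+ b :* (y :* (y :* con true)) := y :* y :* (con true :+ b)) refl b y)

    T : ℤ
    T = ∑F (λ x → χ (g x))

    -- On the radical the form is tr(r² (1 + b)). Extracting the square root makes it linear in r,
    -- which is what separation by the trace requires.
    Tr√≉0 : Tr b ≉ 1# → Tr (√ (1# + b)) ≉ 0#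
    Tr√≉0 Tr-b≉1 eq = Tr-b≉1 (sym (x+y≈0⇒x≈y (begin
      1# + Tr b                   ≈⟨ Tr-1+ b ⟨
      Tr (1# + b)                 ≈⟨ Tr-cong (√-^2 (1# + b)) ⟨
      Tr (√ (1# + b) ^ 2)         ≈⟨ trace-^ m n 1 _ ⟨
      Tr (√ (1# + b)) ^ 2         ≈⟨ ^-congˡ 2 eq ⟩
      0# ^ 2                      ≈⟨ zeroˡ _ ⟩
      0#                          ∎)))

    tr-g-radical : ∀ {r} → r ^ q ≈ r → tr (g r) ≈ tr (r * √ (1# + b))
    tr-g-radical {r} r-fixed = begin
      tr (g r)                            ≈⟨ tr-cong (g-radical r-fixed) ⟩
      tr (r * r * (1# + b))               ≈⟨ tr-cong (*-cong (*-congˡ (*-identityʳ r)) (√-^2 _)) ⟨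
      tr (r ^ 2 * √ (1# + b) ^ 2)         ≈⟨ tr-cong (^-distrib-* r _ 2) ⟨
      tr ((r * √ (1# + b)) ^ 2)           ≈⟨ tr-^2 _ ⟩
      tr (r * √ (1# + b))                 ∎

    polar-0 : ∀ {r} → r ^ q ≈ r → ∀ x → x ^ Q * (r + (r ^ Q) ^ Q) ≈ 0#
    polar-0 {r} r-fixed x = trans (*-congˡ (trans (+-congˡ r^QQ≈r) (x+x≈0 r))) (zeroʳ _)
      where
      r^Q≈r : r ^ Q ≈ r
      r^Q≈r = fixed-^ q r-fixed k
      r^QQ≈r : (r ^ Q) ^ Q ≈ r
      r^QQ≈r = trans (^-congˡ Q r^Q≈r) r^Q≈r

    -- The polar form vanishes at r, so translating by r changes the trace by tr (g r) alone, which
    -- is 1.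
    radical-translation : ∀ {r} → r ^ q ≈ r → tr (r * √ (1# + b)) ≈ 1# → ∀ x → χ (g (x + r)) ≡ ℤ.- χ (g x)
    radical-translation {r} r-fixed tr≈1 x = χ-negate (trans (tr-g-+ x r) (+-congˡ (begin
      tr (g r) + tr (x ^ Q * (r + (r ^ Q) ^ Q))    ≈⟨ +-cong (tr-g-radical r-fixed) (trans (tr-cong (polar-0 r-fixed x)) tr-0) ⟩
      tr (r * √ (1# + b)) + 0#                     ≈⟨ +-identityʳ _ ⟩
      tr (r * √ (1# + b))                          ≈⟨ tr≈1 ⟩
      1#                                           ∎)))

    Tr≉1⇒T≡0 : Tr b ≉ 1# → T ≡ ℤ.0ℤ
    Tr≉1⇒T≡0 Tr-b≉1 = ∑F-antisymmetric (λ eq → χ-cong (g-cong eq)) (proj₁ separated)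
      (radical-translation (proj₁ (proj₂ separated)) (proj₂ (proj₂ separated)))
      where
      separated : ∃ λ r → r ^ q ≈ r × tr (r * √ (1# + b)) ≈ 1#
      separated = Tr≉0⇒separated (Tr√≉0 Tr-b≉1)

    -- T² = ∑ᵧ χ(g(y)) ∑ₓ χ(x^Q (y + y^(Q²))), where the inner sum vanishes unless y lies
    -- in the field with q elements, on which tr ∘ g is zero.
    Tr≈1⇒T≢0 : Tr b ≈ 1# → T ≢ ℤ.0ℤ
    Tr≈1⇒T≢0 Tr-b≈1 T≡0 = ℤ.<-irrefl (≡.sym T²≡0) T²>0
      where
      inner : Carrier → ℤ
      inner y = ∑F (λ x → χ (x ^ Q * (y + (y ^ Q) ^ Q)))

      inner-reindexed : ∀ y → inner y ≡ ∑F (λ z → χ (z * (y + (y ^ Q) ^ Q)))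
      inner-reindexed y = ∑F-reindex (λ eq → χ-cong (*-congʳ eq)) (_^ Q) ^Q-cong ^Q-injective

      term : Carrier → ℤ
      term y = χ (g y) ℤ.* inner y

      term-cong : Congruent _≈_ _≡_ term
      term-cong eq = ≡.cong₂ ℤ._*_ (χ-cong (g-cong eq))
        (∑F-cong (λ x → χ-cong (*-congˡ {x ^ Q} (+-cong eq (^-congˡ Q (^-congˡ Q eq))))))

      term-fixed : ∀ {y} → y + (y ^ Q) ^ Q ≈ 0# → ℤ.0ℤ ℤ.< term y
      term-fixed {y} eq = ≡.subst (ℤ.0ℤ ℤ.<_)
        (≡.sym (≡.trans (≡.cong₂ ℤ._*_ χ-g-y (inner-reindexed y)) (ℤ.*-identityˡ _)))
        (∑χ-trivial eq)
        where
        fixed : y ^ q ≈ y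
        fixed = QQ-fixed⇒q-fixed (sym (x+y≈0⇒x≈y eq))
        Tr-1+b≈0 : Tr (1# + b) ≈ 0#
        Tr-1+b≈0 = trans (Tr-1+ b) (trans (+-congˡ Tr-b≈1) (x+x≈0 1#))
        χ-g-y : χ (g y) ≡ ℤ.1ℤ
        -- Both factors y lie in the field with q elements and leave `Tr` one after the other, so
        -- that Tr (1 + b) ≈ 0 remains.
        χ-g-y = χ-0 (begin
          tr (g y)                                ≈⟨ tr-cong (trans (g-radical fixed) (*-assoc _ _ _)) ⟩
          tr (y * (y * (1# + b)))                 ≈⟨ tr-*ˡ fixed _ ⟩
          trace 1 m (y * Tr (y * (1# + b)))       ≈⟨ trace-cong 1 m (*-congˡ (trans (Tr-*ˡ fixed _) (trans (*-congˡ Tr-1+b≈0) (zeroʳ y)))) ⟩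
          trace 1 m (y * 0#)                      ≈⟨ trace-cong 1 m (zeroʳ y) ⟩
          trace 1 m 0#                            ≈⟨ Trace.φ-0 1 m ⟩
          0#                                      ∎)

      term-moved : ∀ {y} → y + (y ^ Q) ^ Q ≉ 0# → term y ≡ ℤ.0ℤ
      term-moved {y} w≉0 = ≡.trans
        (≡.cong (χ (g y) ℤ.*_) (≡.trans (inner-reindexed y) (∑χ-orthogonal w≉0))) (ℤ.*-zeroʳ (χ (g y)))

      ∑term>0 : ℤ.0ℤ ℤ.< ∑F term
      ∑term>0 = ∑F-pos-on term-cong (λ y → (y + (y ^ Q) ^ Q) ≟ 0#) term-fixed term-moved
        -- The point of the support is y = 1.
        (trans (+-congˡ (trans (^-congˡ Q (1^ Q)) (1^ Q))) (x+x≈0 1#))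

      square : T ℤ.* T ≡ ∑F term
      square = ∑χ-square g-cong tr-g-+

      T²≡0 : T ℤ.* T ≡ ℤ.0ℤ
      T²≡0 = ≡.cong (ℤ._* T) T≡0

      T²>0 : ℤ.0ℤ ℤ.< T ℤ.* T
      T²>0 = ≡.subst (ℤ.0ℤ ℤ.<_) (≡.sym square) ∑term>0

  -- From the quadratic form back to the polynomial

  module _ {d} (a : Vector Carrier d) where

    f : Carrier → Carrier
    f x = x ^ (Q ℕ.+ 1) + linear a (x ^ 2)

    linear-cong : Congruent _≈_ _≈_ (linear a)
    linear-cong eq = sum-cong-≋ {d} (λ i → *-congˡ (^-congˡ (2 ℕ.^ toℕ i) eq))
      where open SemiringSum semiring using (sum-cong-≋)

    f-cong : Congruent _≈_ _≈_ f
    f-cong eq = +-cong (^-congˡ (Q ℕ.+ 1) eq) (linear-cong (^-congˡ 2 eq))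

    coefficient : ∀ {u} → u ≉ 0# → Carrier
    coefficient {u} u≉0 = linear′ a (u ^ (Q ℕ.+ 1)) * (u≉0 ⁻¹) ^ 2

    tr-normalise : ∀ {u} (u≉0 : u ≉ 0#) y →
      tr (f ((u≉0 ⁻¹) * y) * u ^ (Q ℕ.+ 1)) ≈ tr (g (coefficient u≉0) y)
    tr-normalise {u} u≉0 y = begin
      tr (f (v * y) * c₁)                                             ≈⟨ tr-cong (distribʳ _ _ _) ⟩
      tr ((v * y) ^ (Q ℕ.+ 1) * c₁ + linear a ((v * y) ^ 2) * c₁)      ≈⟨ tr-+ _ _ ⟩
      tr ((v * y) ^ (Q ℕ.+ 1) * c₁) + tr (linear a ((v * y) ^ 2) * c₁) ≈⟨ +-cong (tr-cong power-part) linear-part ⟩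
      tr (y ^ (Q ℕ.+ 1)) + tr (coefficient u≉0 * y ^ 2)               ≈⟨ tr-+ _ _ ⟨
      tr (g (coefficient u≉0) y)                                      ∎
      where
      v = u≉0 ⁻¹
      c₁ = u ^ (Q ℕ.+ 1)
      power-part : (v * y) ^ (Q ℕ.+ 1) * c₁ ≈ y ^ (Q ℕ.+ 1)
      power-part = begin
        (v * y) ^ (Q ℕ.+ 1) * u ^ (Q ℕ.+ 1)      ≈⟨ ^-distrib-* (v * y) u (Q ℕ.+ 1) ⟨
        (v * y * u) ^ (Q ℕ.+ 1)                  ≈⟨ ^-congˡ (Q ℕ.+ 1) (begin
          v * y * u       ≈⟨ solve 3 (λ v y u → v :* y :* u := v :* u :* y) refl v y u ⟩
          v * u * y       ≈⟨ *-congʳ (⁻¹-inverseˡ u≉0) ⟩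
          1# * y          ≈⟨ *-identityˡ y ⟩
          y               ∎) ⟩
        y ^ (Q ℕ.+ 1)                            ∎
      linear-part : tr (linear a ((v * y) ^ 2) * c₁) ≈ tr (coefficient u≉0 * y ^ 2)
      linear-part = begin
        tr (linear a ((v * y) ^ 2) * c₁)         ≈⟨ tr-cong (*-comm _ _) ⟩
        tr (c₁ * linear a ((v * y) ^ 2))         ≈⟨ linear-adjoint a ((v * y) ^ 2) c₁ ⟩
        tr ((v * y) ^ 2 * linear′ a c₁)          ≈⟨ tr-cong (trans (*-congʳ (^-distrib-* v y 2))
          (solve 3 (λ V Y L → V :* Y :* L := L :* V :* Y) refl (v ^ 2) (y ^ 2) (linear′ a c₁))) ⟩
        tr (linear′ a c₁ * v ^ 2 * y ^ 2)        ∎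

    ∑χ-normalise : ∀ {u} (u≉0 : u ≉ 0#) → ∑F (λ x → χ (f x * u ^ (Q ℕ.+ 1))) ≡ T (coefficient u≉0)
    ∑χ-normalise {u} u≉0 = ≡.trans
      (≡.sym (∑F-reindex (λ eq → χ-cong (*-congʳ (f-cong eq))) ((u≉0 ⁻¹) *_) *-congˡ (*-cancelˡ v≉0)))
      (∑F-cong (λ y → sign-cong (tr-normalise u≉0 y)))
      where
      v≉0 : (u≉0 ⁻¹) ≉ 0#
      v≉0 v≈0 = 0≉1 (trans (sym (zeroˡ u)) (trans (*-congʳ (sym v≈0)) (⁻¹-inverseˡ u≉0)))

    criterion : Bijective _≈_ _≈_ f ⇔ (∀ {u} (u≉0 : u ≉ 0#) → Tr (coefficient u≉0) ≉ 1#)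
    criterion = mk⇔ to from
      where
      to : Bijective _≈_ _≈_ f → ∀ {u} (u≉0 : u ≉ 0#) → Tr (coefficient u≉0) ≉ 1#
      to (f-inj , _) u≉0 Tr≈1 = Tr≈1⇒T≢0 (coefficient u≉0) Tr≈1
        (≡.trans (≡.sym (∑χ-normalise u≉0)) (injective⇒balanced f-cong f-inj (^-≉0 u≉0 (Q ℕ.+ 1))))

      from : (∀ {u} (u≉0 : u ≉ 0#) → Tr (coefficient u≉0) ≉ 1#) → Bijective _≈_ _≈_ f
      -- Balanced character sums give surjectivity; injectivity then follows from finiteness.
      from Tr≉1 = strictlySurjective⇒injective f f-cong f-surj ,
        λ y → proj₁ (f-surj y) , λ eq → trans (f-cong eq) (proj₂ (f-surj y))
        where
        balanced : ∀ {w} → w ≉ 0# → ∑F (λ x → χ (f x * w)) ≡ ℤ.0ℤ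
        -- Every nonzero multiplier is a (Q+1)-th power, so the normalised sums account for all
        -- nontrivial characters.
        balanced {w} w≉0 with u , eq ← injective⇒strictlySurjective (_^ (Q ℕ.+ 1)) (^-congˡ (Q ℕ.+ 1)) ^[Q+1]-injective w =
          ≡.trans (∑F-cong (λ x → χ-cong (*-congˡ {f x} (sym eq))))
            (≡.trans (∑χ-normalise u≉0) (Tr≉1⇒T≡0 (coefficient u≉0) (Tr≉1 u≉0)))
          where
          u≉0 : u ≉ 0#
          u≉0 u≈0 = w≉0 (trans (sym eq) (trans (^-congˡ (Q ℕ.+ 1) u≈0) (trans (x^[Q+1] 0#) (zeroʳ _))))
        f-surj : ∀ y → ∃ λ x → f x ≈ y
        f-surj = balanced⇒surjective f-cong balanced

theorem9 : ∀ {c ℓ} (m n k : ℕ) → 0 < m → n % 2 ≡ 1 →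
    0 < 2 ℕ.* k → 2 ℕ.* k < n → gcd k n ≡ 1 →
    (F : FiniteField c ℓ ((2 ℕ.^ m) ℕ.^ n)) →
    let open Extension m n F in
    ∀ {d} (a : Vector Carrier d) →
    Bijective _≈_ _≈_ (λ x → x ^ (q ℕ.^ k ℕ.+ 1) + linear a (x ^ 2))
    ⇔
    (∀ {u} (u≉0 : u ≉ 0#) → Tr (linear′ a (u ^ (q ℕ.^ k ℕ.+ 1)) * (u≉0 ⁻¹) ^ 2) ≉ 1#)
theorem9 m n k 0<m n-odd _ _ gcd≡1 F a =
  Quadratic.criterion m n k 0<m n-odd (gcd≡1⇒coprime gcd≡1) F a
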